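{- Let $S\subset\mathbb{Z}_{>0}$ be a finite nonempty set of positive integers and $m=\max(S)$. Then for every integer $n\ge m$, \[ D_S(n,q)=\sum_{k=0}^m b_k(S;q)\begin{bmatrix} n-k\\ m-k+1\end{bmatrix}_q, \] where $b_0(S;q)=0$ and for $k\ge1$, \[ b_k(S;q)=\sum_{\substack{\pi\in A(S;m+1)\\ \pi(m+1)=k}} q^{\ell(\pi)}\in\mathbb{R}_{\geq 0}[q]. \] Moreover, $(b_k(S;q))_{k=0,\ldots,m}$ is a strongly $q$-log concave sequence.
   Context: For $\pi=\pi_1\cdots\pi_n\in\mathfrak{S}_n$ in one-line notation, $\mathrm{Des}(\pi)=\{i\in[n-1]: \pi_i>\pi_{i+1}\}$ and $\ell(\pi)=|\{(i,j): 1\le i<j\le n,\ \pi_i>\pi_j\}|$. $A(S;n)=\{\pi\in\mathfrak{S}_n:\mathrm{Des}(\pi)=S\}$ and $D_S(n,q)=\sum_{\pi\in A(S;n)}q^{\ell(\pi)}$. $[k]_q=1+q+\cdots+q^{k-1}$, $[k]!_q=[1]_q\cdots[k]_q$, $\begin{bmatrix} n\\ k\end{bmatrix}_q=\frac{[n]!_q}{[n-k]!_q[k]!_q}$ for $0\le k\le n$, and $0$ if $k>n\ge0$. A sequence $(a_i(q))_{i=0,\ldots,k}$ in $\mathbb{R}_{\geq0}[q]$ is strongly $q$-log concave if it has no internal zeroes (if $a_i\neq0$, $a_{j'}\neq0$, $i<j<j'$, then $a_j\ne0$) and $a_i(q)a_j(q)-a_{i-1}(q)a_{j+1}(q)$ has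 nonnegative coefficients for all $i\le j$, with out-of-range terms taken as $0$. -}

module Defs where

open import Data.Nat using (ℕ; zero; suc; _+_; _*_; _∸_; _⊔_; _≤_; _<_; _≡ᵇ_; _<ᵇ_)
open import Data.Bool using (Bool; true; false; not; _∧_; if_then_else_)
open import Data.List using (List; []; _∷_; [_]; _++_; map; concatMap; foldr; replicate; upTo)
open import Data.Bool.ListAction using (any; all)
open import Data.Product using (_×_)
open import Relation.Nullary using (¬_)
open import Relation.Binary.PropositionalEquality using (_≡_)

-- Polynomials in q with coefficients in ℕ (⊆ ℝ≥0), as coefficient
-- lists  [c₀, c₁, …]  meaning  c₀ + c₁ q + c₂ q² + …

Poly : Set
Poly = List ℕ

coeff : Poly → ℕ → ℕ
coeff []      _       = 0
coeff (a ∷ p) zero    = a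
coeff (a ∷ p) (suc d) = coeff p d

_≈P_ : Poly → Poly → Set
p ≈P r = ∀ d → coeff p d ≡ coeff r d

IsZeroP : Poly → Set
IsZeroP p = ∀ d → coeff p d ≡ 0

_+P_ : Poly → Poly → Poly
[]      +P r       = r
(a ∷ p) +P []      = a ∷ p
(a ∷ p) +P (b ∷ r) = (a + b) ∷ (p +P r)

_·P_ : ℕ → Poly → Poly
a ·P r = map (a *_) r

_*P_ : Poly → Poly → Poly
[]      *P r = []
(a ∷ p) *P r = (a ·P r) +P (0 ∷ (p *P r))

sumP : List Poly → Poly
sumP = foldr _+P_ []

qpow : ℕ → Poly
qpow k = replicate k 0 ++ [ 1 ]

-- Permutations of [n] in one-line notation, as lists π₁ … πₙ of
-- natural numbers.

elemᵇ : ℕ → List ℕ → Bool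
elemᵇ x xs = any (x ≡ᵇ_) xs

distinct : List ℕ → Bool
distinct []       = true
distinct (x ∷ xs) = not (elemᵇ x xs) ∧ distinct xs

filterᵇ : {A : Set} → (A → Bool) → List A → List A
filterᵇ p []       = []
filterᵇ p (x ∷ xs) = if p x then x ∷ filterᵇ p xs else filterᵇ p xs

words : ℕ → ℕ → List (List ℕ)
words n zero    = [ [] ]
words n (suc k) = concatMap (λ w → map (λ a → a ∷ w) (map suc (upTo n))) (words n k)

Sym : ℕ → List (List ℕ)
Sym n = filterᵇ distinct (words n n)

countLess : ℕ → List ℕ → ℕ
countLess x []       = 0
countLess x (y ∷ ys) = (if y <ᵇ x then 1 else 0) + countLess x ys

inv : List ℕ → ℕ
inv []       = 0
inv (x ∷ xs) = countLess x xs + inv xs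

desFrom : ℕ → List ℕ → List ℕ
desFrom i []           = []
desFrom i (x ∷ [])     = []
desFrom i (x ∷ y ∷ ws) =
  if y <ᵇ x then i ∷ desFrom (suc i) (y ∷ ws) else desFrom (suc i) (y ∷ ws)

Des : List ℕ → List ℕ
Des π = desFrom 1 π

sameSet : List ℕ → List ℕ → Bool
sameSet xs ys = all (λ x → elemᵇ x ys) xs ∧ all (λ y → elemᵇ y xs) ys

A : List ℕ → ℕ → List (List ℕ)
A S n = filterᵇ (λ π → sameSet (Des π) S) (Sym n)

D : List ℕ → ℕ → Poly
D S n = sumP (map (λ π → qpow (inv π)) (A S n))

maxL : List ℕ → ℕ
maxL = foldr _⊔_ 0

lastEntry : List ℕ → ℕ
lastEntry []           = 0
lastEntry (x ∷ [])     = x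
lastEntry (x ∷ y ∷ ws) = lastEntry (y ∷ ws)

b : List ℕ → ℕ → Poly
b S zero    = []
b S (suc k) =
  sumP (map (λ π → qpow (inv π))
            (filterᵇ (λ π → lastEntry π ≡ᵇ suc k) (A S (suc (maxL S)))))

-- Gaussian binomial coefficient [n choose k]_q (0 if k > n),
-- via the q-Pascal recursion  [n+1,k+1] = [n,k] + q^{k+1} [n,k+1].

gauss : ℕ → ℕ → Poly
gauss zero    zero    = [ 1 ]
gauss zero    (suc k) = []
gauss (suc n) zero    = [ 1 ]
gauss (suc n) (suc k) = gauss n k +P (qpow (suc k) *P gauss n (suc k))

-- Strong q-log-concavity of a finite sequence a₀,…,a_k (given as a
-- list; out-of-range terms are 0).

at : List Poly → ℕ → Poly
at []       _       = []
at (a ∷ as) zero    = a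
at (a ∷ as) (suc i) = at as i

atPred : List Poly → ℕ → Poly
atPred as zero    = []
atPred as (suc i) = at as i

_≤P_ : Poly → Poly → Set
p ≤P r = ∀ d → coeff p d ≤ coeff r d

NoInternalZeros : List Poly → Set
NoInternalZeros as = ∀ i j j' → i < j → j < j' →
  ¬ IsZeroP (at as i) → ¬ IsZeroP (at as j') → ¬ IsZeroP (at as j)

StronglyQLogConcave : List Poly → Set
StronglyQLogConcave as =
  NoInternalZeros as ×
  (∀ i j → i ≤ j →
     (atPred as i *P at as (suc j)) ≤P (at as i *P at as j))

{-# OPTIONS --safe #-}

-- Build permutations by appending a last entry k to the standardised rest.
-- Let f_n(k) be the generating polynomial of the permutations of [n] ending in
-- k whose descents agree with S.  Appending k to a permutation of [n] creates
-- n+1-k inversions, so f_{n+1}(k) is q^{n+1-k} times the sum of f_n(j) over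
-- j ≥ k if n ∈ S, and over j < k otherwise.  Partial sums from either end and
-- multiplication by q^{n+1-k} preserve strong q-log-concavity, and since m ∈ S
-- the last step makes the support of b_k = f_{m+1}(k) an initial segment of
-- k ≥ 1.  After position m there are only ascents, and iterating the recursion
-- N times gives
--   Σ_{j ≤ x} f_{m+1+N}(j) = q^{N (m+1+N-x)} Σ_k b_k [x-k choose N]_q,
-- the q-Pascal rule being exactly the induction step; x = n = m+1+N is the
-- expansion of D_S(n,q).

module Submission where

open import Defs
open import Algebra.Bundles using (CommutativeSemigroup; CommutativeSemiring)
open import Data.Nat as ℕ using (ℕ; zero; suc)
import Data.Nat.Properties as ℕ
open import Level using (0ℓ; _⊔_)
open import Relation.Binary.PropositionalEquality as ≡ using (_≡_; _≢_)
open import Relation.Nullary using (¬_; yes; no; T?)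

-- Strong log-concavity, with its arbitrary gaps, is what the induction can carry: a product of
-- partial sums expands into products of terms at any distance, so each must be comparable with
-- every inner pair of the same index sum. The identity for the sums over j ≤ x is proved for every
-- x because, once only ascents follow, f_{n+1}(k) is itself a prefix sum of f_n; the recursion
-- closes on prefix sums, not on their total D_S(n,q). Its exponent counts inversions: the N
-- appended entries increase to a last entry ≤ x, so each of the m+1+N-x values above x stands
-- before all of them. The recursion produces lower index N = n-m-1, whereas the theorem has m-k+1.
-- The two are complementary in n-k, so the symmetry of Gaussian binomials enters; as `gauss` is
-- defined by one q-Pascal rule, the other has to be derived. The case n = m lies before the first
-- level of this recursion and is settled separately: both sides vanish.

module LogConcavity {c ℓ} (R : CommutativeSemiring c ℓ) where
  open CommutativeSemiring R
  open import Algebra.Properties.CommutativeSemigroup +-commutativeSemigroup using (interchange)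
  open import Algebra.Properties.CommutativeSemigroup *-commutativeSemigroup using () renaming (interchange to *-interchange)

  -- In ℕ[q] this implies the coefficientwise order, and unlike the latter it
  -- makes sense in every commutative semiring.
  infix 4 _≼_
  record _≼_ (x y : Carrier) : Set (c ⊔ ℓ) where
    constructor mk≼
    field
      {rest} : Carrier
      split  : x + rest ≈ y

  ≼-reflexive : ∀ {x y} → x ≈ y → x ≼ y
  ≼-reflexive e = mk≼ (trans (+-identityʳ _) e)

  ≼-trans : ∀ {x y z} → x ≼ y → y ≼ z → x ≼ z
  ≼-trans (mk≼ e) (mk≼ f) = mk≼ (trans (sym (+-assoc _ _ _)) (trans (+-congʳ e) f))

  ≼-resp : ∀ {x x' y y'} → x ≈ x' → y ≈ y' → x ≼ y → x' ≼ y'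
  ≼-resp e f (mk≼ g) = mk≼ (trans (+-congʳ (sym e)) (trans g f))

  0≼ : ∀ {x y} → x ≈ 0# → x ≼ y
  0≼ e = mk≼ (trans (+-congʳ e) (+-identityˡ _))

  +-mono : ∀ {x x' y y'} → x ≼ x' → y ≼ y' → x + y ≼ x' + y'
  +-mono (mk≼ e) (mk≼ f) = mk≼ (trans (interchange _ _ _ _) (+-cong e f))

  *-monoʳ : ∀ z {x y} → x ≼ y → z * x ≼ z * y
  *-monoʳ z (mk≼ e) = mk≼ (trans (sym (distribˡ z _ _)) (*-congˡ e))

  -- `StepLC` moves both indices inwards by one, as in the definition of strong log-concavity; `LC`
  -- allows any inner pair with the same index sum, which is what the partial-sum arguments consume.
  -- Indices are given by their differences to avoid truncated subtraction.
  StepLC LC : (ℕ → Carrier) → Set _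
  StepLC a = ∀ i e → a i * a (suc (suc (i ℕ.+ e))) ≼ a (suc i) * a (suc (i ℕ.+ e))
  LC     a = ∀ i d e → a i * a (i ℕ.+ d ℕ.+ e) ≼ a (i ℕ.+ d) * a (i ℕ.+ e)

  -- Both indices move one step towards each other until one of them has travelled d or e.
  StepLC⇒LC : ∀ {a} → StepLC a → LC a
  StepLC⇒LC {a} lc i zero e rewrite ℕ.+-identityʳ i = ≼-reflexive refl
  StepLC⇒LC {a} lc i (suc d) zero
    rewrite ℕ.+-identityʳ (i ℕ.+ suc d) | ℕ.+-identityʳ i = ≼-reflexive (*-comm _ _)
  StepLC⇒LC {a} lc i (suc d) (suc e) = ≼-trans
    (≡.subst (λ x → a i * a x ≼ a (suc i) * a (suc (i ℕ.+ (d ℕ.+ e)))) index (lc i (d ℕ.+ e)))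
    (≡.subst₂ (λ x y → a (suc i) * a (suc (i ℕ.+ (d ℕ.+ e))) ≼ a x * a y)
      (≡.sym (ℕ.+-suc i d)) (≡.sym (ℕ.+-suc i e))
      (≡.subst (λ x → a (suc i) * a (suc x) ≼ a (suc (i ℕ.+ d)) * a (suc (i ℕ.+ e)))
        (ℕ.+-assoc i d e) (StepLC⇒LC lc (suc i) d e)))
    where
    index : suc (suc (i ℕ.+ (d ℕ.+ e))) ≡ i ℕ.+ suc d ℕ.+ suc e
    index = ≡.sym (≡.trans (ℕ.+-suc _ e)
      (≡.cong suc (≡.trans (≡.cong (ℕ._+ e) (ℕ.+-suc i d)) (≡.cong suc (ℕ.+-assoc i d e)))))

  -- Log-concavity of partial sums and of geometrically weighted sequences

  module _ {a s : ℕ → Carrier} (lc : LC a)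
           (s-zero : s 0 ≈ 0#) (s-suc : ∀ x → s (suc x) ≈ s x + a x) where

    private
      -- Termwise, a t · a (i + δ) ≼ a i · a (t + δ) for t ≤ i.
      compare : ∀ u d δ → s u * a (u ℕ.+ d ℕ.+ δ) ≼ a (u ℕ.+ d) * s (u ℕ.+ δ)
      compare zero    d δ = 0≼ (trans (*-congʳ s-zero) (zeroˡ _))
      compare (suc u) d δ = ≼-resp
        (trans (sym (distribʳ _ (s u) (a u))) (*-congʳ (sym (s-suc u))))
        (trans (sym (distribˡ _ _ _)) (*-congˡ (sym (s-suc (u ℕ.+ δ)))))
        (+-mono
          (≡.subst (λ x → s u * a (x ℕ.+ δ) ≼ a x * s (u ℕ.+ δ)) (ℕ.+-suc u d) (compare u (suc d) δ))
          (≡.subst (λ x → a u * a (x ℕ.+ δ) ≼ a x * a (u ℕ.+ δ)) (ℕ.+-suc u d) (lc u (suc d) δ)))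

    -- Expanding the larger index on the left and the smaller one on the right leaves `s i * s j` on
    -- both sides. What remains is `s i * a j ≼ a i * s j`, the case `d = 0` of `compare`.
    prefixSums-StepLC : StepLC s
    prefixSums-StepLC i e = ≼-resp
      (trans (sym (distribˡ (s i) (s j) (a j))) (*-congˡ (sym (s-suc j))))
      (trans (sym (distribʳ (s j) (s i) (a i))) (*-congʳ (sym (s-suc i))))
      (+-mono (≼-reflexive refl) gap)
      where
      j = suc (i ℕ.+ e)
      gap : s i * a j ≼ a i * s j
      gap = ≡.subst₂ (λ x y → s i * a x ≼ a y * s j) (ℕ.+-suc i e) (ℕ.+-identityʳ i)
        (≡.subst (λ y → s i * a (i ℕ.+ suc e) ≼ a (i ℕ.+ 0) * s y) (ℕ.+-suc i e)
          (≡.subst (λ x → s i * a (x ℕ.+ suc e) ≼ a (i ℕ.+ 0) * s (i ℕ.+ suc e))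
            (ℕ.+-identityʳ i) (compare i 0 (suc e))))

  module _ {a s : ℕ → Carrier} (lc : LC a) (N : ℕ)
           (s-big : ∀ x → N ℕ.≤ x → s x ≈ 0#) (s-step : ∀ x → s x ≈ a x + s (suc x)) where

    private
      -- Termwise again, now `a i * a (t + δ) ≼ a t * a (i + δ)` for `t ≥ i + d`. A suffix sum
      -- unfolds upwards, so `k` serves as fuel: it falls while `d` grows, and when it is used up
      -- the sum starts beyond `N` and vanishes.
      compare : ∀ k i d δ → N ℕ.≤ k ℕ.+ d →
                a i * s (i ℕ.+ d ℕ.+ δ) ≼ s (i ℕ.+ d) * a (i ℕ.+ δ)
      compare zero    i d δ N≤ = 0≼ (trans
        (*-congˡ (s-big _ (ℕ.≤-trans N≤ (ℕ.≤-trans (ℕ.m≤n+m d i) (ℕ.m≤m+n _ δ))))) (zeroʳ _))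
      compare (suc k) i d δ N≤ = ≼-resp
        (trans (sym (distribˡ _ _ _)) (*-congˡ (sym (s-step _))))
        (trans (sym (distribʳ _ _ _)) (*-congʳ (sym (s-step _))))
        (+-mono (lc i d δ)
          (≡.subst (λ x → a i * s (x ℕ.+ δ) ≼ s x * a (i ℕ.+ δ)) (ℕ.+-suc i d)
            (compare k i (suc d) δ (ℕ.≤-trans N≤ (ℕ.≤-reflexive (≡.sym (ℕ.+-suc k d)))))))

    suffixSums-StepLC : StepLC s
    suffixSums-StepLC i e = ≼-resp
      (trans (sym (distribʳ (s (suc j)) (a i) (s (suc i)))) (*-congʳ (sym (s-step i))))
      (trans (sym (distribˡ (s (suc i)) (a j) (s (suc j)))) (*-congˡ (sym (s-step j))))
      (+-mono gap (≼-reflexive refl))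
      where
      j = suc (i ℕ.+ e)
      gap : a i * s (suc j) ≼ s (suc i) * a j
      gap = ≡.subst₂ (λ x y → a i * s x ≼ s (suc i) * a y) (≡.cong suc (ℕ.+-suc i e)) (ℕ.+-suc i e)
        (≡.subst (λ x → a i * s (x ℕ.+ suc e) ≼ s x * a (i ℕ.+ suc e)) (ℕ.+-comm i 1)
          (compare N i 1 (suc e) (ℕ.m≤m+n N 1)))

  module _ {a s w : ℕ → Carrier} (N : ℕ) (lc : StepLC s)
           (w-geometric : ∀ i e → suc (suc (i ℕ.+ e)) ℕ.≤ N →
              w i * w (suc (suc (i ℕ.+ e))) ≈ w (suc i) * w (suc (i ℕ.+ e)))
           (a-zero : a 0 ≈ 0#) (a-big : ∀ k → N ℕ.< k → a k ≈ 0#)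
           (a-scaled : ∀ k → 0 ℕ.< k → k ℕ.≤ N → a k ≈ w k * s k) where

    -- The weights contribute the same factor to both sides. Cutting the sequence off outside 1,
    -- ..., `N` is harmless: the outer indices leave this range first, and then the left side is
    -- zero.
    scaled-StepLC : StepLC a
    scaled-StepLC zero    e = 0≼ (trans (*-congʳ a-zero) (zeroˡ _))
    scaled-StepLC (suc i) e with suc (suc (suc i ℕ.+ e)) ℕ.≤? N
    ... | no  j≰N = 0≼ (trans (*-congˡ (a-big _ (ℕ.≰⇒> j≰N))) (zeroʳ _))
    ... | yes j≤N = ≼-resp
      (trans (*-interchange _ _ _ _) (sym (*-cong (a-scaled _ (ℕ.s≤s ℕ.z≤n) i≤N) (a-scaled _ (ℕ.s≤s ℕ.z≤n) j≤N))))
      (trans (*-congʳ (w-geometric (suc i) e j≤N))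
        (trans (*-interchange _ _ _ _) (sym (*-cong (a-scaled _ (ℕ.s≤s ℕ.z≤n) i+1≤N) (a-scaled _ (ℕ.s≤s ℕ.z≤n) j-1≤N)))))
      (*-monoʳ _ (lc (suc i) e))
      where
      j-1≤N = ℕ.<⇒≤ j≤N
      i+1≤N = ℕ.≤-trans (ℕ.s≤s (ℕ.s≤s (ℕ.m≤m+n i e))) j-1≤N
      i≤N   = ℕ.<⇒≤ i+1≤N

open import Algebra.Structures using (IsCommutativeMonoid)
open import Algebra.Structures.Biased using (IsCommutativeSemiringˡ)
open import Data.Bool using (Bool; true; false; not; _∧_; if_then_else_; T)
open import Data.Bool.Properties using (T-∧; ∧-identityʳ; ∧-assoc; ∧-comm; not-involutive)
open import Data.Empty using (⊥-elim)
open import Data.List using (List; []; _∷_; [_]; _∷ʳ_; _++_; map; concatMap; filter; length; upTo; applyUpTo; cartesianProductWith; initLast; _∷ʳ′_)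
open import Data.List.Properties using (length-++; length-map; ∷ʳ-injective; map-injective; map-∘; upTo-∷ʳ)
open import Data.List.Membership.Propositional using (_∈_)
open import Data.List.Membership.Propositional.Properties using (∈-map⁺; ∈-map⁻; ∈-upTo⁺; ∈-upTo⁻; ∈-filter⁺; ∈-filter⁻; ∈-cartesianProductWith⁺; ∈-cartesianProductWith⁻)
open import Data.List.Membership.Propositional.Properties.WithK using (unique∧set⇒bag)
open import Data.List.Relation.Binary.BagAndSetEquality using (∼bag⇒↭)
open import Data.List.Relation.Binary.Permutation.Propositional as ↭ using (_↭_)
open import Data.List.Relation.Unary.All as All using (All; []; _∷_)
import Data.List.Relation.Unary.All.Properties as All
open import Data.List.Relation.Unary.AllPairs using ([]; _∷_)
open import Data.List.Relation.Unary.Any as Any using (here; there)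
import Data.List.Relation.Unary.Any.Properties as Any
open import Data.List.Relation.Unary.Unique.Propositional using (Unique)
import Data.List.Relation.Unary.Unique.Propositional.Properties as Unique
open import Data.Nat using (_+_; _*_; _∸_; _⊓_; _≤_; _<_; z≤n; s≤s; _<ᵇ_; _≡ᵇ_; _≤?_; _<?_)
open import Data.Nat.Properties
open import Data.Product using (∃; _×_; _,_; proj₁; proj₂)
open import Data.Sum using (inj₁; inj₂)
open import Function using (_∘_; id; mk⇔; Equivalence)
open import Relation.Binary using (IsEquivalence)
open ≡ using (refl; sym; trans; cong; cong₂; subst; module ≡-Reasoning)

-- The semiring ℕ[q]

-- A record around _≈P_, so that both polynomials can be inferred from a proof.
infix 4 _≋_
record _≋_ (p r : Poly) : Set where
  constructor mk≋
  field coeffs : p ≈P r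
open _≋_ public

≋-isEquivalence : IsEquivalence _≋_
≋-isEquivalence = record
  { refl  = mk≋ λ _ → refl
  ; sym   = λ e → mk≋ λ d → sym (coeffs e d)
  ; trans = λ e f → mk≋ λ d → trans (coeffs e d) (coeffs f d)
  }

coeff-+ : ∀ p r d → coeff (p +P r) d ≡ coeff p d + coeff r d
coeff-+ []      r       d       = refl
coeff-+ (a ∷ p) []      d       = sym (+-identityʳ _)
coeff-+ (a ∷ p) (b ∷ r) zero    = refl
coeff-+ (a ∷ p) (b ∷ r) (suc d) = coeff-+ p r d

coeff-· : ∀ a r d → coeff (a ·P r) d ≡ a * coeff r d
coeff-· a []      d       = sym (*-zeroʳ a)
coeff-· a (b ∷ r) zero    = refl
coeff-· a (b ∷ r) (suc d) = coeff-· a r d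

+P-isCommutativeMonoid : IsCommutativeMonoid _≋_ _+P_ []
+P-isCommutativeMonoid = record
  { isMonoid = record
    { isSemigroup = record
      { isMagma = record
        { isEquivalence = ≋-isEquivalence
        ; ∙-cong = λ {p} {p'} {r} {r'} e f → mk≋ λ d →
            trans (coeff-+ p r d) (trans (cong₂ _+_ (coeffs e d) (coeffs f d)) (sym (coeff-+ p' r' d)))
        }
      ; assoc = λ p r s → mk≋ λ d → begin
          coeff ((p +P r) +P s) d              ≡⟨ coeff-+ (p +P r) s d ⟩
          coeff (p +P r) d + coeff s d         ≡⟨ cong (_+ _) (coeff-+ p r d) ⟩
          coeff p d + coeff r d + coeff s d    ≡⟨ +-assoc (coeff p d) _ _ ⟩
          coeff p d + (coeff r d + coeff s d)  ≡⟨ cong (coeff p d +_) (coeff-+ r s d) ⟨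
          coeff p d + coeff (r +P s) d         ≡⟨ coeff-+ p (r +P s) d ⟨
          coeff (p +P (r +P s)) d              ∎
      }
    ; identity = (λ _ → mk≋ λ _ → refl) , λ p → mk≋ λ d → trans (coeff-+ p [] d) (+-identityʳ _)
    }
  ; comm = λ p r → mk≋ λ d →
      trans (coeff-+ p r d) (trans (+-comm (coeff p d) _) (sym (coeff-+ r p d)))
  }
  where open ≡-Reasoning

module +P = IsCommutativeMonoid +P-isCommutativeMonoid

+P-commutativeSemigroup : CommutativeSemigroup 0ℓ 0ℓ
+P-commutativeSemigroup = record { isCommutativeSemigroup = +P.isCommutativeSemigroup }

∷-cong : ∀ {a b p r} → a ≡ b → p ≋ r → (a ∷ p) ≋ (b ∷ r)
∷-cong e f = mk≋ λ { zero → e ; (suc d) → coeffs f d }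

0∷-+ : ∀ p r → (0 ∷ (p +P r)) ≋ ((0 ∷ p) +P (0 ∷ r))
0∷-+ p r = mk≋ λ { zero → refl ; (suc d) → refl }

·-congʳ : ∀ a {p r} → p ≋ r → (a ·P p) ≋ (a ·P r)
·-congʳ a {p} {r} e = mk≋ λ d →
  trans (coeff-· a p d) (trans (cong (a *_) (coeffs e d)) (sym (coeff-· a r d)))

·-distribˡ : ∀ a p r → (a ·P (p +P r)) ≋ ((a ·P p) +P (a ·P r))
·-distribˡ a p r = mk≋ λ d → begin
  coeff (a ·P (p +P r)) d                ≡⟨ coeff-· a (p +P r) d ⟩
  a * coeff (p +P r) d                   ≡⟨ cong (a *_) (coeff-+ p r d) ⟩
  a * (coeff p d + coeff r d)            ≡⟨ *-distribˡ-+ a (coeff p d) _ ⟩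
  a * coeff p d + a * coeff r d          ≡⟨ cong₂ _+_ (coeff-· a p d) (coeff-· a r d) ⟨
  coeff (a ·P p) d + coeff (a ·P r) d    ≡⟨ coeff-+ (a ·P p) (a ·P r) d ⟨
  coeff ((a ·P p) +P (a ·P r)) d         ∎
  where open ≡-Reasoning

·-distribʳ : ∀ a b p → ((a + b) ·P p) ≋ ((a ·P p) +P (b ·P p))
·-distribʳ a b p = mk≋ λ d → begin
  coeff ((a + b) ·P p) d                 ≡⟨ coeff-· (a + b) p d ⟩
  (a + b) * coeff p d                    ≡⟨ *-distribʳ-+ (coeff p d) a b ⟩
  a * coeff p d + b * coeff p d          ≡⟨ cong₂ _+_ (coeff-· a p d) (coeff-· b p d) ⟨
  coeff (a ·P p) d + coeff (b ·P p) d    ≡⟨ coeff-+ (a ·P p) (b ·P p) d ⟨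
  coeff ((a ·P p) +P (b ·P p)) d         ∎
  where open ≡-Reasoning

·-assoc : ∀ a b p → ((a * b) ·P p) ≋ (a ·P (b ·P p))
·-assoc a b p = mk≋ λ d → begin
  coeff ((a * b) ·P p) d     ≡⟨ coeff-· (a * b) p d ⟩
  a * b * coeff p d          ≡⟨ *-assoc a b _ ⟩
  a * (b * coeff p d)        ≡⟨ cong (a *_) (coeff-· b p d) ⟨
  a * coeff (b ·P p) d       ≡⟨ coeff-· a (b ·P p) d ⟨
  coeff (a ·P (b ·P p)) d    ∎
  where open ≡-Reasoning

·-identity : ∀ p → (1 ·P p) ≋ p
·-identity p = mk≋ λ d → trans (coeff-· 1 p d) (*-identityˡ _)

0·-zero : ∀ p → (0 ·P p) ≋ []
0·-zero p = mk≋ λ d → coeff-· 0 p d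

0∷-zero : ∀ {p} → p ≋ [] → (0 ∷ p) ≋ []
0∷-zero e = mk≋ λ { zero → refl ; (suc d) → coeffs e d }

module _ where
  open import Relation.Binary.Reasoning.Setoid +P.setoid
  open import Algebra.Properties.CommutativeSemigroup +P-commutativeSemigroup using (interchange; x∙yz≈y∙xz)

  *P-congˡ : ∀ p {r s} → r ≋ s → (p *P r) ≋ (p *P s)
  *P-congˡ []      e = +P.refl
  *P-congˡ (a ∷ p) e = +P.∙-cong (·-congʳ a e) (∷-cong refl (*P-congˡ p e))

  *P-zeroʳ : ∀ p → (p *P []) ≋ []
  *P-zeroʳ []      = +P.refl
  *P-zeroʳ (a ∷ p) = 0∷-zero (*P-zeroʳ p)

  -- `*P` recurses on its left factor. This is the same recursion on the right one; it yields
  -- commutativity, and through it congruence in the left factor.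
  *P-∷ : ∀ p b r → (p *P (b ∷ r)) ≋ ((b ·P p) +P (0 ∷ (p *P r)))
  *P-∷ []      b r = +P.sym (0∷-zero +P.refl)
  *P-∷ (a ∷ p) b r = ∷-cong (cong (_+ 0) (*-comm a b)) (begin
    (a ·P r) +P (p *P (b ∷ r))               ≈⟨ +P.∙-cong +P.refl (*P-∷ p b r) ⟩
    (a ·P r) +P ((b ·P p) +P (0 ∷ (p *P r)))  ≈⟨ x∙yz≈y∙xz (a ·P r) (b ·P p) _ ⟩
    (b ·P p) +P ((a ·P r) +P (0 ∷ (p *P r)))  ∎)

  *P-comm : ∀ p r → (p *P r) ≋ (r *P p)
  *P-comm []      r = +P.sym (*P-zeroʳ r)
  *P-comm (a ∷ p) r = begin
    (a ·P r) +P (0 ∷ (p *P r))  ≈⟨ +P.∙-cong +P.refl (∷-cong refl (*P-comm p r)) ⟩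
    (a ·P r) +P (0 ∷ (r *P p))  ≈⟨ *P-∷ r a p ⟨
    r *P (a ∷ p)                ∎

  *P-cong : ∀ {p p' r r'} → p ≋ p' → r ≋ r' → (p *P r) ≋ (p' *P r')
  *P-cong {p} {p'} {r} {r'} e f = begin
    p *P r    ≈⟨ *P-congˡ p f ⟩
    p *P r'   ≈⟨ *P-comm p r' ⟩
    r' *P p   ≈⟨ *P-congˡ r' e ⟩
    r' *P p'  ≈⟨ *P-comm r' p' ⟩
    p' *P r'  ∎

  *P-distribʳ : ∀ s p r → ((p +P r) *P s) ≋ ((p *P s) +P (r *P s))
  *P-distribʳ s []      r       = +P.refl
  *P-distribʳ s (a ∷ p) []      = +P.sym (+P.identityʳ _)
  *P-distribʳ s (a ∷ p) (b ∷ r) = begin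
    ((a + b) ·P s) +P (0 ∷ ((p +P r) *P s))
      ≈⟨ +P.∙-cong (·-distribʳ a b s) (+P.trans (∷-cong refl (*P-distribʳ s p r)) (0∷-+ (p *P s) (r *P s))) ⟩
    ((a ·P s) +P (b ·P s)) +P ((0 ∷ (p *P s)) +P (0 ∷ (r *P s)))
      ≈⟨ interchange (a ·P s) (b ·P s) _ _ ⟩
    ((a ·P s) +P (0 ∷ (p *P s))) +P ((b ·P s) +P (0 ∷ (r *P s)))  ∎

  ·-*P : ∀ a p r → ((a ·P p) *P r) ≋ (a ·P (p *P r))
  ·-*P a []      r = +P.refl
  ·-*P a (b ∷ p) r = begin
    ((a * b) ·P r) +P (0 ∷ ((a ·P p) *P r))
      ≈⟨ +P.∙-cong (·-assoc a b r) (∷-cong (sym (*-zeroʳ a)) (·-*P a p r)) ⟩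
    (a ·P (b ·P r)) +P (a ·P (0 ∷ (p *P r)))
      ≈⟨ ·-distribˡ a (b ·P r) _ ⟨
    a ·P ((b ·P r) +P (0 ∷ (p *P r)))  ∎

  0∷-*P : ∀ p r → ((0 ∷ p) *P r) ≋ (0 ∷ (p *P r))
  0∷-*P p r = +P.∙-cong (0·-zero r) +P.refl

  *P-assoc : ∀ p r s → ((p *P r) *P s) ≋ (p *P (r *P s))
  *P-assoc []      r s = +P.refl
  *P-assoc (a ∷ p) r s = begin
    ((a ·P r) +P (0 ∷ (p *P r))) *P s
      ≈⟨ *P-distribʳ s (a ·P r) _ ⟩
    ((a ·P r) *P s) +P ((0 ∷ (p *P r)) *P s)
      ≈⟨ +P.∙-cong (·-*P a r s) (+P.trans (0∷-*P (p *P r) s) (∷-cong refl (*P-assoc p r s))) ⟩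
    (a ·P (r *P s)) +P (0 ∷ (p *P (r *P s)))  ∎

  *P-identityˡ : ∀ p → ([ 1 ] *P p) ≋ p
  *P-identityˡ p = begin
    (1 ·P p) +P (0 ∷ [])  ≈⟨ +P.∙-cong (·-identity p) (0∷-zero +P.refl) ⟩
    p +P []               ≈⟨ +P.identityʳ p ⟩
    p                     ∎

  *P-isCommutativeMonoid : IsCommutativeMonoid _≋_ _*P_ [ 1 ]
  *P-isCommutativeMonoid = record
    { isMonoid = record
      { isSemigroup = record
        { isMagma = record { isEquivalence = ≋-isEquivalence ; ∙-cong = *P-cong }
        ; assoc   = *P-assoc
        }
      ; identity = *P-identityˡ , λ p → +P.trans (*P-comm p [ 1 ]) (*P-identityˡ p)
      }
    ; comm = *P-comm
    }

polySemiring : CommutativeSemiring 0ℓ 0ℓ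
polySemiring = record
  { isCommutativeSemiring = IsCommutativeSemiringˡ.isCommutativeSemiring record
    { +-isCommutativeMonoid = +P-isCommutativeMonoid
    ; *-isCommutativeMonoid = *P-isCommutativeMonoid
    ; distribʳ              = *P-distribʳ
    ; zeroˡ                 = λ _ → +P.refl
    }
  }

qpow-+ : ∀ a b → qpow (a + b) ≋ (qpow a *P qpow b)
qpow-+ zero    b = +P.sym (*P-identityˡ (qpow b))
qpow-+ (suc a) b = +P.trans (∷-cong refl (qpow-+ a b)) (+P.sym (0∷-*P (qpow a) (qpow b)))

-- Permutations, inversions and descents

T-elemᵇ⁺ : ∀ {x xs} → x ∈ xs → T (elemᵇ x xs)
T-elemᵇ⁺ x∈ = Any.any⁺ _ (Any.map (≡⇒≡ᵇ _ _) x∈)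

T-elemᵇ⁻ : ∀ {x} xs → T (elemᵇ x xs) → x ∈ xs
T-elemᵇ⁻ xs t = Any.map (≡ᵇ⇒≡ _ _) (Any.any⁻ _ xs t)

T-not⁺ : ∀ {β} → ¬ T β → T (not β)
T-not⁺ {false} _ = _
T-not⁺ {true}  n = n _

T-not⁻ : ∀ {β} → T (not β) → ¬ T β
T-not⁻ {false} _ t = t

distinct⁺ : ∀ {xs} → Unique xs → T (distinct xs)
distinct⁺ []         = _
distinct⁺ (x∉ ∷ xs!) = Equivalence.from T-∧
  (T-not⁺ (λ t → All.lookup x∉ (T-elemᵇ⁻ _ t) refl) , distinct⁺ xs!)

distinct⁻ : ∀ xs → T (distinct xs) → Unique xs
distinct⁻ []       _ = []
distinct⁻ (x ∷ xs) t with Equivalence.to T-∧ t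
... | x∉ , xs! = All.tabulate (λ { y∈ refl → T-not⁻ x∉ (T-elemᵇ⁺ y∈) }) ∷ distinct⁻ xs xs!

filterᵇ≡filter : ∀ {X : Set} p (L : List X) → filterᵇ p L ≡ filter (T? ∘ p) L
filterᵇ≡filter p []      = refl
filterᵇ≡filter p (x ∷ L) with p x
... | true  = cong (x ∷_) (filterᵇ≡filter p L)
... | false = filterᵇ≡filter p L

concatMap-map : ∀ {X Y Z : Set} (f : X → Y → Z) L M →
  concatMap (λ x → map (f x) M) L ≡ cartesianProductWith f L M
concatMap-map f []      M = refl
concatMap-map f (x ∷ L) M = cong (map (f x) M ++_) (concatMap-map f L M)

[1‥_] : ℕ → List ℕ
[1‥ n ] = map suc (upTo n)

InRange : ℕ → ℕ → Set
InRange n x = 0 < x × x ≤ n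

∈[1‥]⁺ : ∀ {n x} → InRange n x → x ∈ [1‥ n ]
∈[1‥]⁺ {x = suc x} (_ , x<n) = ∈-map⁺ suc (∈-upTo⁺ x<n)

∈[1‥]⁻ : ∀ {n x} → x ∈ [1‥ n ] → InRange n x
∈[1‥]⁻ x∈ with ∈-map⁻ suc x∈
... | _ , y∈ , refl = s≤s z≤n , ∈-upTo⁻ y∈

[1‥]-unique : ∀ n → Unique [1‥ n ]
[1‥]-unique n = Unique.map⁺ suc-injective (Unique.upTo⁺ n)

words-suc : ∀ n k → words n (suc k) ≡ cartesianProductWith (λ w a → a ∷ w) (words n k) [1‥ n ]
words-suc n k = concatMap-map (λ w a → a ∷ w) (words n k) [1‥ n ]

words-unique : ∀ n k → Unique (words n k)
words-unique n zero    = [] ∷ []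
words-unique n (suc k) rewrite words-suc n k =
  Unique.cartesianProductWith⁺ _ (λ { refl → refl , refl }) (words-unique n k) ([1‥]-unique n)

∈-words⁺ : ∀ {n w} → All (InRange n) w → w ∈ words n (length w)
∈-words⁺               []       = here refl
∈-words⁺ {n} {a ∷ w} (a∈ ∷ w∈) rewrite words-suc n (length w) =
  ∈-cartesianProductWith⁺ (λ w a → a ∷ w) (∈-words⁺ w∈) (∈[1‥]⁺ a∈)

∈-words⁻ : ∀ n k {w} → w ∈ words n k → length w ≡ k × All (InRange n) w
∈-words⁻ n zero    (here refl) = refl , []
∈-words⁻ n (suc k) w∈ rewrite words-suc n k
  with ∈-cartesianProductWith⁻ (λ w a → a ∷ w) (words n k) [1‥ n ] w∈
... | w' , a , w'∈ , a∈ , refl with ∈-words⁻ n k w'∈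
... | refl , all = refl , ∈[1‥]⁻ a∈ ∷ all

record PermWord (n : ℕ) (w : List ℕ) : Set where
  constructor permWord
  field
    len    : length w ≡ n
    ranges : All (InRange n) w
    unique : Unique w

Sym-unique : ∀ n → Unique (Sym n)
Sym-unique n rewrite filterᵇ≡filter distinct (words n n) =
  Unique.filter⁺ (T? ∘ distinct) (words-unique n n)

∈-Sym⁺ : ∀ {n w} → PermWord n w → w ∈ Sym n
∈-Sym⁺ {n} (permWord refl r u) rewrite filterᵇ≡filter distinct (words n n) =
  ∈-filter⁺ (T? ∘ distinct) (∈-words⁺ r) (distinct⁺ u)

∈-Sym⁻ : ∀ {n w} → w ∈ Sym n → PermWord n w
∈-Sym⁻ {n} w∈ rewrite filterᵇ≡filter distinct (words n n)
  with ∈-filter⁻ (T? ∘ distinct) {xs = words n n} w∈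
... | w∈words , d with ∈-words⁻ n n w∈words
... | l , r = permWord l r (distinct⁻ _ d)

-- Permutations built from their last entry

punchIn : ℕ → ℕ → ℕ
punchIn zero    x       = suc x
punchIn (suc k) zero    = zero
punchIn (suc k) (suc x) = suc (punchIn k x)

punchIn-injective : ∀ k {x y} → punchIn k x ≡ punchIn k y → x ≡ y
punchIn-injective zero                    e = suc-injective e
punchIn-injective (suc k) {zero}  {zero}  e = refl
punchIn-injective (suc k) {suc x} {suc y} e = cong suc (punchIn-injective k (suc-injective e))

punchIn-≢ : ∀ k x → punchIn k x ≢ k
punchIn-≢ (suc k) (suc x) e = punchIn-≢ k x (suc-injective e)

punchIn-surjective : ∀ {k y} → y ≢ k → ∃ λ x → y ≡ punchIn k x
punchIn-surjective {zero}  {zero}  y≢k = ⊥-elim (y≢k refl)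
punchIn-surjective {zero}  {suc y} y≢k = y , refl
punchIn-surjective {suc k} {zero}  y≢k = zero , refl
punchIn-surjective {suc k} {suc y} y≢k with punchIn-surjective {k} {y} (y≢k ∘ cong suc)
... | x , refl = suc x , refl

punchIn-InRange : ∀ {n} k {x} → InRange n x → InRange (suc n) (punchIn k x)
punchIn-InRange k (0<x , x≤n) = pos k 0<x , ≤-trans (bound k _) (s≤s x≤n)
  where
  pos : ∀ k {x} → 0 < x → 0 < punchIn k x
  pos zero            _ = s≤s z≤n
  pos (suc k) {suc x} _ = s≤s z≤n
  bound : ∀ k x → punchIn k x ≤ suc x
  bound zero    x       = ≤-refl
  bound (suc k) zero    = z≤n
  bound (suc k) (suc x) = s≤s (bound k x)

-- Values from `k` on are raised by one, so they were at most `n`; values below `k` are at most `n`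
-- because `k ≤ suc n`.
punchIn-InRange⁻ : ∀ {n k x} → InRange (suc n) k → InRange (suc n) (punchIn k x) → InRange n x
punchIn-InRange⁻ {n} {suc k} {suc x} (_ , k≤) (_ , x≤) = s≤s z≤n , bound {n} {suc k} {suc x} k≤ x≤
  where
  bound : ∀ {n k x} → k ≤ suc n → punchIn k x ≤ suc n → x ≤ n
  bound {k = zero}                    _        (s≤s x≤) = x≤
  bound {k = suc k}       {zero}      _        _        = z≤n
  bound {zero} {suc zero} {suc x}     _        (s≤s ())
  bound {zero} {suc (suc k)} {suc x}  (s≤s ()) _
  bound {suc n} {suc k}   {suc x}     (s≤s k≤) (s≤s x≤) = s≤s (bound k≤ x≤)

append : List ℕ → ℕ → List ℕ
append w k = map (punchIn k) w ∷ʳ k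

append-injective : ∀ {w w' k k'} → append w k ≡ append w' k' → w ≡ w' × k ≡ k'
append-injective {w} {w'} {k} {k'} e with ∷ʳ-injective (map (punchIn k) w) (map (punchIn k') w') e
... | maps , refl = map-injective (punchIn-injective k) maps , refl

Perms : ℕ → List (List ℕ)
Perms zero    = [ [] ]
Perms (suc n) = cartesianProductWith append (Perms n) [1‥ suc n ]

Perms-unique : ∀ n → Unique (Perms n)
Perms-unique zero    = [] ∷ []
Perms-unique (suc n) =
  Unique.cartesianProductWith⁺ append append-injective (Perms-unique n) ([1‥]-unique (suc n))

Unique-∷ʳ⁻ : ∀ w {k : ℕ} → Unique (w ∷ʳ k) → Unique w × All (_≢ k) w
Unique-∷ʳ⁻ []      _          = [] , []
Unique-∷ʳ⁻ (x ∷ w) (x∉ ∷ w!) with Unique-∷ʳ⁻ w w! | All.++⁻ w x∉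
... | w!' , k∉ | x∉w , (x≢k ∷ []) = x∉w ∷ w!' , x≢k ∷ k∉

unmap-punchIn : ∀ k {w} → All (_≢ k) w → ∃ λ w' → w ≡ map (punchIn k) w'
unmap-punchIn k []          = [] , refl
unmap-punchIn k (x≢k ∷ w≢k) with punchIn-surjective x≢k | unmap-punchIn k w≢k
... | x' , refl | w' , refl = x' ∷ w' , refl

length-append : ∀ w k → length (append w k) ≡ suc (length w)
length-append w k = trans (length-++ (map (punchIn k) w))
  (trans (+-comm _ 1) (cong suc (length-map (punchIn k) w)))

∈-Perms⁻ : ∀ n {w} → w ∈ Perms n → PermWord n w
∈-Perms⁻ zero    (here refl) = permWord refl [] []
∈-Perms⁻ (suc n) w∈ with ∈-cartesianProductWith⁻ append (Perms n) [1‥ suc n ] w∈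
... | w , k , w∈' , k∈ , refl with ∈-Perms⁻ n w∈'
... | permWord refl r u = permWord (length-append w k)
  (All.++⁺ (All.map⁺ (All.map (punchIn-InRange k) r)) (∈[1‥]⁻ k∈ ∷ []))
  (Unique.++⁺ (Unique.map⁺ (punchIn-injective k) u) ([] ∷ []) disjoint)
  where
  disjoint : ∀ {v} → ¬ (v ∈ map (punchIn k) w × v ∈ [ k ])
  disjoint (v∈ , here refl) with ∈-map⁻ (punchIn k) v∈
  ... | x , _ , k≡ = punchIn-≢ k x (sym k≡)

∈-Perms⁺ : ∀ n {w} → PermWord n w → w ∈ Perms n
∈-Perms⁺ zero    {[]} _ = here refl
∈-Perms⁺ (suc n) {w} (permWord l r u) with initLast w
∈-Perms⁺ (suc n) (permWord l r u) | w ∷ʳ′ k with Unique-∷ʳ⁻ w u | All.++⁻ w r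
... | u' , w≢k | rw , (rk ∷ []) with unmap-punchIn k w≢k
... | w' , refl = ∈-cartesianProductWith⁺ append
  (∈-Perms⁺ n (permWord (suc-injective (trans (sym (length-append w' k)) l))
    (All.map (punchIn-InRange⁻ rk) (All.map⁻ rw)) (Unique.map⁻ u')))
  (∈[1‥]⁺ rk)

-- Two duplicate-free lists with the same elements are equal as bags. Reordering is all that is
-- needed, since the lists only serve as index sets of sums.
Sym↭Perms : ∀ n → Sym n ↭ Perms n
Sym↭Perms n = ∼bag⇒↭ (unique∧set⇒bag (Sym-unique n) (Perms-unique n)
  (mk⇔ (∈-Perms⁺ n ∘ ∈-Sym⁻) (∈-Sym⁺ ∘ ∈-Perms⁻ n)))

-- Inversions created by a new last entry

punchIn-<ᵇ : ∀ k x y → (punchIn k x <ᵇ punchIn k y) ≡ (x <ᵇ y)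
punchIn-<ᵇ zero    x       y       = refl
punchIn-<ᵇ (suc k) zero    zero    = refl
punchIn-<ᵇ (suc k) zero    (suc y) = refl
punchIn-<ᵇ (suc k) (suc x) zero    = refl
punchIn-<ᵇ (suc k) (suc x) (suc y) = punchIn-<ᵇ k x y

-- Exactly the values from `k` on are pushed past `k`. Hence inversions and the descent at the new
-- last entry `k` can be tested on the word before insertion.
<ᵇ-punchIn : ∀ k x → (k <ᵇ punchIn k x) ≡ not (x <ᵇ k)
<ᵇ-punchIn zero    x       = refl
<ᵇ-punchIn (suc k) zero    = refl
<ᵇ-punchIn (suc k) (suc x) = <ᵇ-punchIn k x

punchIn-<ᵇ-below : ∀ {k c} x → k ≤ c → (punchIn c x <ᵇ k) ≡ (x <ᵇ k)
punchIn-<ᵇ-below x       z≤n      = refl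
punchIn-<ᵇ-below zero    (s≤s k≤) = refl
punchIn-<ᵇ-below (suc x) (s≤s k≤) = punchIn-<ᵇ-below x k≤

punchIn-<ᵇ-above : ∀ {k c} x → c ≤ k → (punchIn c x <ᵇ suc k) ≡ (x <ᵇ k)
punchIn-<ᵇ-above x       z≤n      = refl
punchIn-<ᵇ-above zero    (s≤s c≤) = refl
punchIn-<ᵇ-above (suc x) (s≤s c≤) = punchIn-<ᵇ-above x c≤

indicator : Bool → ℕ
indicator β = if β then 1 else 0

count : (ℕ → Bool) → List ℕ → ℕ
count p []      = 0
count p (x ∷ w) = indicator (p x) + count p w

count-∷ʳ : ∀ p w k → count p (w ∷ʳ k) ≡ count p w + indicator (p k)
count-∷ʳ p []      k = +-identityʳ _
count-∷ʳ p (x ∷ w) k = trans (cong (indicator (p x) +_) (count-∷ʳ p w k)) (sym (+-assoc (indicator (p x)) _ _))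

count-map : ∀ {p r} f w → (∀ x → p (f x) ≡ r x) → count p (map f w) ≡ count r w
count-map f []      e = refl
count-map f (x ∷ w) e = cong₂ _+_ (cong indicator (e x)) (count-map f w e)

countLess≡count : ∀ x w → countLess x w ≡ count (_<ᵇ x) w
countLess≡count x []      = refl
countLess≡count x (y ∷ w) = cong (indicator (y <ᵇ x) +_) (countLess≡count x w)

inv-∷ʳ : ∀ w k → inv (w ∷ʳ k) ≡ inv w + count (k <ᵇ_) w
inv-∷ʳ []      k = refl
inv-∷ʳ (x ∷ w) k = begin
  countLess x (w ∷ʳ k) + inv (w ∷ʳ k)
    ≡⟨ cong₂ _+_ (trans (countLess≡count x (w ∷ʳ k)) (count-∷ʳ (_<ᵇ x) w k)) (inv-∷ʳ w k) ⟩
  (count (_<ᵇ x) w + indicator (k <ᵇ x)) + (inv w + count (k <ᵇ_) w)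
    ≡⟨ interchange (count (_<ᵇ x) w) _ _ _ ⟩
  (count (_<ᵇ x) w + inv w) + (indicator (k <ᵇ x) + count (k <ᵇ_) w)
    ≡⟨ cong (λ c → c + inv w + (indicator (k <ᵇ x) + count (k <ᵇ_) w)) (countLess≡count x w) ⟨
  (countLess x w + inv w) + (indicator (k <ᵇ x) + count (k <ᵇ_) w)  ∎
  where
  open ≡-Reasoning
  open import Algebra.Properties.CommutativeSemigroup +-commutativeSemigroup using (interchange)

inv-map-punchIn : ∀ k w → inv (map (punchIn k) w) ≡ inv w
inv-map-punchIn k []      = refl
inv-map-punchIn k (x ∷ w) = cong₂ _+_
  (trans (countLess≡count _ (map (punchIn k) w))
    (trans (count-map (punchIn k) w (λ y → punchIn-<ᵇ k y x)) (sym (countLess≡count x w))))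
  (inv-map-punchIn k w)

atLeast : ℕ → ℕ → Bool
atLeast k x = not (x <ᵇ k)

inv-append : ∀ w k → inv (append w k) ≡ inv w + count (atLeast k) w
inv-append w k = trans (inv-∷ʳ (map (punchIn k) w) k)
  (cong₂ _+_ (inv-map-punchIn k w) (count-map (punchIn k) w (<ᵇ-punchIn k)))

<⇒<ᵇ≡true : ∀ {m n} → m < n → (m <ᵇ n) ≡ true
<⇒<ᵇ≡true (s≤s z≤n)         = refl
<⇒<ᵇ≡true (s≤s (s≤s m<n)) = <⇒<ᵇ≡true (s≤s m<n)

≥⇒<ᵇ≡false : ∀ {m n} → n ≤ m → (m <ᵇ n) ≡ false
≥⇒<ᵇ≡false z≤n       = refl
≥⇒<ᵇ≡false (s≤s n≤m) = ≥⇒<ᵇ≡false n≤m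

-- Induction along `append`, by comparing `k` with the last entry `c`. If `k ≤ c`, then `c` is
-- counted and the threshold for the rest stays `k`; if `c < k`, then `c` is not counted and
-- removing it lowers the threshold to `k - 1`.
count-atLeast : ∀ n {w} → w ∈ Perms n → ∀ k → InRange (suc n) k → count (atLeast k) w + k ≡ suc n
count-atLeast zero    (here refl) k (0<k , k≤1) = ≤-antisym k≤1 0<k
count-atLeast (suc n) w∈ k (0<k , k≤) with ∈-cartesianProductWith⁻ append (Perms n) [1‥ suc n ] w∈
... | w , c , w∈' , c∈ , refl with ∈[1‥]⁻ c∈ | k ≤? c
... | 0<c , c≤ | yes k≤c = begin
  count (atLeast k) (append w c) + k
    ≡⟨ cong (_+ k) (trans (count-∷ʳ _ (map (punchIn c) w) c)
         (cong₂ _+_ (count-map (punchIn c) w (λ x → cong not (punchIn-<ᵇ-below x k≤c)))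
                    (cong (indicator ∘ not) (≥⇒<ᵇ≡false k≤c)))) ⟩
  count (atLeast k) w + 1 + k   ≡⟨ cong (_+ k) (+-comm _ 1) ⟩
  suc (count (atLeast k) w + k) ≡⟨ cong suc (count-atLeast n w∈' k (0<k , ≤-trans k≤c c≤)) ⟩
  suc (suc n)                   ∎
  where open ≡-Reasoning
... | 0<c , c≤ | no k≰c with k
... | zero   = ⊥-elim (k≰c z≤n)
... | suc k' = begin
  count (atLeast (suc k')) (append w c) + suc k'
    ≡⟨ cong (_+ suc k') (trans (count-∷ʳ _ (map (punchIn c) w) c)
         (cong₂ _+_ (count-map (punchIn c) w (λ x → cong not (punchIn-<ᵇ-above x c≤k')))
                    (cong (indicator ∘ not) (<⇒<ᵇ≡true (s≤s c≤k'))))) ⟩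
  count (atLeast k') w + 0 + suc k'   ≡⟨ cong (_+ suc k') (+-identityʳ _) ⟩
  count (atLeast k') w + suc k'       ≡⟨ +-suc _ k' ⟩
  suc (count (atLeast k') w + k')     ≡⟨ cong suc (count-atLeast n w∈' k' (≤-trans 0<c c≤k' , ≤-pred k≤)) ⟩
  suc (suc n)                         ∎
  where
  open ≡-Reasoning
  c≤k' : c ≤ k'
  c≤k' = ≤-pred (≰⇒> k≰c)

lastEntry-∷ʳ : ∀ w k → lastEntry (w ∷ʳ k) ≡ k
lastEntry-∷ʳ []          k = refl
lastEntry-∷ʳ (x ∷ [])    k = refl
lastEntry-∷ʳ (x ∷ y ∷ w) k = lastEntry-∷ʳ (y ∷ w) k

lastEntry-map : ∀ (f : ℕ → ℕ) x w → lastEntry (map f (x ∷ w)) ≡ f (lastEntry (x ∷ w))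
lastEntry-map f x []      = refl
lastEntry-map f x (y ∷ w) = lastEntry-map f y w

lastEntry-InRange : ∀ {n w} → PermWord (suc n) w → InRange (suc n) (lastEntry w)
lastEntry-InRange {w = x ∷ w} (permWord _ r _) = go x w r
  where
  go : ∀ {P : ℕ → Set} x w → All P (x ∷ w) → P (lastEntry (x ∷ w))
  go x []      (px ∷ _)  = px
  go x (y ∷ w) (_ ∷ pyw) = go y w pyw

-- Descent sets as conditions on each position

module Pattern (S : List ℕ) where

  agrees : ℕ → Bool → Bool
  agrees i β = if elemᵇ i S then β else not β

  -- Unlike the condition Des π = S, this one is inherited by prefixes.
  fits : ℕ → List ℕ → Bool
  fits i []          = true
  fits i (x ∷ [])    = true
  fits i (x ∷ y ∷ w) = agrees i (y <ᵇ x) ∧ fits (suc i) (y ∷ w)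

  fits-map-punchIn : ∀ k i w → fits i (map (punchIn k) w) ≡ fits i w
  fits-map-punchIn k i []          = refl
  fits-map-punchIn k i (x ∷ [])    = refl
  fits-map-punchIn k i (x ∷ y ∷ w) =
    cong₂ _∧_ (cong (agrees i) (punchIn-<ᵇ k y x)) (fits-map-punchIn k (suc i) (y ∷ w))

  fits-∷ʳ : ∀ i x w k →
    fits i ((x ∷ w) ∷ʳ k) ≡ (fits i (x ∷ w) ∧ agrees (i + length w) (k <ᵇ lastEntry (x ∷ w)))
  fits-∷ʳ i x []      k rewrite +-identityʳ i = ∧-identityʳ _
  fits-∷ʳ i x (y ∷ w) k rewrite +-suc i (length w) = trans
    (cong (agrees i (y <ᵇ x) ∧_) (fits-∷ʳ (suc i) y w k))
    (sym (∧-assoc (agrees i (y <ᵇ x)) _ _))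

  fits-append : ∀ {n w} → PermWord (suc n) w → ∀ k →
    fits 1 (append w k) ≡ (fits 1 w ∧ agrees (suc n) (atLeast k (lastEntry w)))
  fits-append {n} {x ∷ w} (permWord l _ _) k = begin
    fits 1 (map (punchIn k) (x ∷ w) ∷ʳ k)
      ≡⟨ fits-∷ʳ 1 (punchIn k x) (map (punchIn k) w) k ⟩
    (fits 1 (map (punchIn k) (x ∷ w)) ∧
      agrees (suc (length (map (punchIn k) w))) (k <ᵇ lastEntry (map (punchIn k) (x ∷ w))))
      ≡⟨ cong₂ _∧_ (fits-map-punchIn k 1 (x ∷ w)) (cong₂ agrees
           (trans (cong suc (length-map (punchIn k) w)) l)
           (trans (cong (k <ᵇ_) (lastEntry-map (punchIn k) x w)) (<ᵇ-punchIn k _))) ⟩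
    (fits 1 (x ∷ w) ∧ agrees (suc n) (atLeast k (lastEntry (x ∷ w))))  ∎
    where open ≡-Reasoning

  desFrom-≥ : ∀ i x w {j} → j ∈ desFrom i (x ∷ w) → i ≤ j
  desFrom-≥ i x (y ∷ w) j∈ with y <ᵇ x
  desFrom-≥ i x (y ∷ w) (here refl) | true  = ≤-refl
  desFrom-≥ i x (y ∷ w) (there j∈)  | true  = <⇒≤ (desFrom-≥ (suc i) y w j∈)
  desFrom-≥ i x (y ∷ w) j∈          | false = <⇒≤ (desFrom-≥ (suc i) y w j∈)

  desFrom-< : ∀ i x w {j} → j ∈ desFrom i (x ∷ w) → j < i + length w
  desFrom-< i x (y ∷ w) {j} j∈ rewrite +-suc i (length w) with y <ᵇ x
  desFrom-< i x (y ∷ w) (here refl) | true  = s≤s (m≤m+n i _)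
  desFrom-< i x (y ∷ w) (there j∈)  | true  = desFrom-< (suc i) y w j∈
  desFrom-< i x (y ∷ w) j∈          | false = desFrom-< (suc i) y w j∈

  fits⇒⊆ : ∀ i x w → T (fits i (x ∷ w)) → ∀ {j} → j ∈ desFrom i (x ∷ w) → j ∈ S
  fits⇒⊆ i x (y ∷ w) t j∈ with elemᵇ i S in eq | y <ᵇ x
  fits⇒⊆ i x (y ∷ w) t (here refl) | true  | true  = T-elemᵇ⁻ S (subst T (sym eq) _)
  fits⇒⊆ i x (y ∷ w) t (there j∈)  | true  | true  = fits⇒⊆ (suc i) y w t j∈
  fits⇒⊆ i x (y ∷ w) t j∈          | false | false = fits⇒⊆ (suc i) y w t j∈

  fits⇒⊇ : ∀ i x w → T (fits i (x ∷ w)) →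
           ∀ {j} → j ∈ S → i ≤ j → j < i + length w → j ∈ desFrom i (x ∷ w)
  fits⇒⊇ i x []      t j∈ i≤j j< = ⊥-elim (<⇒≱ j< (≤-trans (≤-reflexive (+-identityʳ i)) i≤j))
  fits⇒⊇ i x (y ∷ w) t j∈ i≤j j< rewrite +-suc i (length w)
    with elemᵇ i S in eq | y <ᵇ x | m≤n⇒m<n∨m≡n i≤j
  ... | true  | true  | inj₁ i<j  = there (fits⇒⊇ (suc i) y w t j∈ i<j j<)
  ... | true  | true  | inj₂ refl = here refl
  ... | false | false | inj₁ i<j  = fits⇒⊇ (suc i) y w t j∈ i<j j<
  ... | false | false | inj₂ refl = ⊥-elim (subst T eq (T-elemᵇ⁺ j∈))

  -- The second inclusion is restricted to `i ≤ j` because `desFrom i` lists no earlier position. An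
  -- ascent at some `i ∈ S` contradicts this inclusion, since `desFrom (suc i)` starts later than
  -- `i`; a descent at some `i ∉ S` contradicts the first one.
  ⊆⊇⇒fits : ∀ i x w → (∀ {j} → j ∈ desFrom i (x ∷ w) → j ∈ S) →
            (∀ {j} → j ∈ S → i ≤ j → j ∈ desFrom i (x ∷ w)) → T (fits i (x ∷ w))
  ⊆⊇⇒fits i x []      sub sup = _
  ⊆⊇⇒fits i x (y ∷ w) sub sup with elemᵇ i S in eq | y <ᵇ x
  ... | true  | true  = ⊆⊇⇒fits (suc i) y w (sub ∘ there)
    λ j∈ i<j → Any.tail (<⇒≢ i<j ∘ sym) (sup j∈ (<⇒≤ i<j))
  ... | true  | false = <-irrefl refl
    (desFrom-≥ (suc i) y w (sup (T-elemᵇ⁻ S (subst T (sym eq) _)) ≤-refl))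
  ... | false | true  = subst T eq (T-elemᵇ⁺ (sub (here refl)))
  ... | false | false = ⊆⊇⇒fits (suc i) y w sub (λ j∈ i<j → sup j∈ (<⇒≤ i<j))

  sameSet⁻ : ∀ w → T (sameSet (Des w) S) →
             (∀ {j} → j ∈ Des w → j ∈ S) × (∀ {j} → j ∈ S → j ∈ Des w)
  sameSet⁻ w t with Equivalence.to T-∧ t
  ... | sub , sup =
    (λ j∈ → T-elemᵇ⁻ S (All.lookup (All.all⁺ _ (Des w) sub) j∈)) ,
    (λ j∈ → T-elemᵇ⁻ (Des w) (All.lookup (All.all⁺ _ S sup) j∈))

  -- `fits` only inspects positions inside the word, so elements of `S` outside them would go
  -- unnoticed; `bound` excludes such elements. It will hold for permutations of [n] with n > max S.
  sameSet≡fits : ∀ x w → (∀ {j} → j ∈ S → InRange (length w) j) →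
                 sameSet (Des (x ∷ w)) S ≡ fits 1 (x ∷ w)
  sameSet≡fits x w bound = T-ext
    (λ t → let sub , sup = sameSet⁻ (x ∷ w) t in ⊆⊇⇒fits 1 x w sub (λ j∈ _ → sup j∈))
    (λ t → Equivalence.from T-∧
      ( All.all⁻ _ (All.tabulate (T-elemᵇ⁺ ∘ fits⇒⊆ 1 x w t))
      , All.all⁻ _ (All.tabulate λ j∈ → T-elemᵇ⁺
          (fits⇒⊇ 1 x w t j∈ (proj₁ (bound j∈)) (s≤s (proj₂ (bound j∈)))))))
    where
    T-ext : ∀ {α β} → (T α → T β) → (T β → T α) → α ≡ β
    T-ext {true}  {true}  _ _ = refl
    T-ext {true}  {false} f _ = ⊥-elim (f _)
    T-ext {false} {true}  _ g = ⊥-elim (g _)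
    T-ext {false} {false} _ _ = refl

  -- An element of `S` beyond the last possible descent position can never be matched. This is the
  -- situation at n = max S.
  sameSet≡false : ∀ x w {j} → j ∈ S → length w < j → sameSet (Des (x ∷ w)) S ≡ false
  sameSet≡false x w {j} j∈ l<j with sameSet (Des (x ∷ w)) S in eq
  ... | false = refl
  ... | true  = ⊥-elim (<⇒≱
    (desFrom-< 1 x w (proj₂ (sameSet⁻ (x ∷ w) (subst T (sym eq) _)) j∈)) l<j)

module ℕ[q] = CommutativeSemiring polySemiring
open import Relation.Binary.Reasoning.Setoid ℕ[q].setoid
open import Algebra.Properties.CommutativeSemigroup ℕ[q].+-commutativeSemigroup using (interchange; x∙yz≈y∙xz)
open import Algebra.Solver.Ring.NaturalCoefficients.Default polySemiring using (solve; con; _:=_; _:+_; _:*_)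
open LogConcavity polySemiring

-- Gaussian binomials and finite sums

qpow-suc : ∀ n → qpow (suc n) ≋ (qpow 1 *P qpow n)
qpow-suc = qpow-+ 1

gauss-above : ∀ n k → n < k → gauss n k ≋ []
gauss-above zero    (suc k) _         = ℕ[q].refl
gauss-above (suc n) (suc k) (s≤s n<k) = begin
  gauss n k +P (qpow (suc k) *P gauss n (suc k))
    ≈⟨ ℕ[q].+-cong (gauss-above n k n<k) (ℕ[q].*-congˡ {qpow (suc k)} (gauss-above n (suc k) (m<n⇒m<1+n n<k))) ⟩
  qpow (suc k) *P []
    ≈⟨ ℕ[q].zeroʳ (qpow (suc k)) ⟩
  []  ∎

-- [ a + b , a ], parametrised so that the symmetry exchanges the two arguments.
gauss₂ : ℕ → ℕ → Poly
gauss₂ zero    b       = [ 1 ]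
gauss₂ (suc a) zero    = [ 1 ]
gauss₂ (suc a) (suc b) = gauss₂ a (suc b) +P (qpow (suc a) *P gauss₂ (suc a) b)

gauss≋gauss₂ : ∀ a b → gauss (a + b) a ≋ gauss₂ a b
gauss≋gauss₂ zero    zero    = ℕ[q].refl
gauss≋gauss₂ zero    (suc b) = ℕ[q].refl
gauss≋gauss₂ (suc a) zero    = begin
  gauss (a + 0) a +P (qpow (suc a) *P gauss (a + 0) (suc a))
    ≈⟨ ℕ[q].+-cong (gauss≋gauss₂ a 0)
         (ℕ[q].*-congˡ {qpow (suc a)} (gauss-above (a + 0) (suc a) (s≤s (≤-reflexive (+-identityʳ a))))) ⟩
  gauss₂ a 0 +P (qpow (suc a) *P [])
    ≈⟨ ℕ[q].+-cong (ℕ[q].reflexive (gauss₂-0 a)) (ℕ[q].zeroʳ (qpow (suc a))) ⟩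
  [ 1 ]  ∎
  where
  gauss₂-0 : ∀ a → gauss₂ a 0 ≡ [ 1 ]
  gauss₂-0 zero    = ≡.refl
  gauss₂-0 (suc a) = ≡.refl
gauss≋gauss₂ (suc a) (suc b) = ℕ[q].+-cong (gauss≋gauss₂ a (suc b))
  (ℕ[q].*-congˡ {qpow (suc a)} (ℕ[q].trans
    (ℕ[q].reflexive (≡.cong (λ x → gauss x (suc a)) (+-suc a b))) (gauss≋gauss₂ (suc a) b)))

-- This is the defining rule of `gauss₂ (suc b) (suc a)` as it will read once symmetry is known, so
-- it must be proved independently. In the main case both summands of the defining rule are expanded
-- by the dual one; after regrouping, the pieces fold back by the defining rule.
gauss₂-dualPascal : ∀ a b →
  gauss₂ (suc a) (suc b) ≋ ((qpow (suc b) *P gauss₂ a (suc b)) +P gauss₂ (suc a) b)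
gauss₂-dualPascal zero    zero    = mk≋ λ { zero → ≡.refl ; (suc d) → ≡.refl }
gauss₂-dualPascal zero    (suc b) = begin
  [ 1 ] +P (qpow 1 *P gauss₂ 1 (suc b))
    ≈⟨ ℕ[q].+-congˡ {[ 1 ]} (ℕ[q].*-congˡ {qpow 1} (gauss₂-dualPascal 0 b)) ⟩
  [ 1 ] +P (qpow 1 *P ((qpow (suc b) *P [ 1 ]) +P gauss₂ 1 b))
    ≈⟨ solve 3 (λ q x g → con 1 :+ q :* (x :* con 1 :+ g) := q :* x :* con 1 :+ (con 1 :+ q :* g)) ℕ[q].refl (qpow 1) (qpow (suc b)) (gauss₂ 1 b) ⟩
  ((qpow 1 *P qpow (suc b)) *P [ 1 ]) +P ([ 1 ] +P (qpow 1 *P gauss₂ 1 b))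
    ≈⟨ ℕ[q].+-congʳ {[ 1 ] +P (qpow 1 *P gauss₂ 1 b)} (ℕ[q].*-congʳ {[ 1 ]} (qpow-suc (suc b))) ⟨
  (qpow (suc (suc b)) *P [ 1 ]) +P ([ 1 ] +P (qpow 1 *P gauss₂ 1 b))  ∎
gauss₂-dualPascal (suc a) zero    = begin
  gauss₂ (suc a) 1 +P (qpow (suc (suc a)) *P [ 1 ])
    ≈⟨ ℕ[q].+-cong (gauss₂-dualPascal a 0) (ℕ[q].*-congʳ {[ 1 ]} (qpow-suc (suc a))) ⟩
  ((qpow 1 *P gauss₂ a 1) +P [ 1 ]) +P ((qpow 1 *P qpow (suc a)) *P [ 1 ])
    ≈⟨ solve 3 (λ q x g → (q :* g :+ con 1) :+ q :* x :* con 1 := q :* (g :+ x :* con 1) :+ con 1) ℕ[q].refl (qpow 1) (qpow (suc a)) (gauss₂ a 1) ⟩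
  (qpow 1 *P (gauss₂ a 1 +P (qpow (suc a) *P [ 1 ]))) +P [ 1 ]  ∎
gauss₂-dualPascal (suc a) (suc b) = begin
  gauss₂ (suc a) (suc (suc b)) +P (qpow (suc (suc a)) *P gauss₂ (suc (suc a)) (suc b))
    ≈⟨ ℕ[q].+-cong (gauss₂-dualPascal a (suc b))
         (ℕ[q].*-cong (qpow-suc (suc a)) (gauss₂-dualPascal (suc a) b)) ⟩
  ((qpow (suc (suc b)) *P x) +P y) +P ((q *P qa) *P ((qb *P y) +P z))
    ≈⟨ ℕ[q].+-congʳ (ℕ[q].+-congʳ (ℕ[q].*-congʳ {x} (qpow-suc (suc b)))) ⟩
  (((q *P qb) *P x) +P y) +P ((q *P qa) *P ((qb *P y) +P z))
    ≈⟨ solve 6 (λ q qa qb x y z → (q :* qb :* x :+ y) :+ q :* qa :* (qb :* y :+ z)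
                                := q :* qb :* (x :+ qa :* y) :+ (y :+ q :* qa :* z)) ℕ[q].refl q qa qb x y z ⟩
  ((q *P qb) *P (x +P (qa *P y))) +P (y +P ((q *P qa) *P z))
    ≈⟨ ℕ[q].+-cong (ℕ[q].*-congʳ {x +P (qa *P y)} (qpow-suc (suc b))) (ℕ[q].+-congˡ {y} (ℕ[q].*-congʳ {z} (qpow-suc (suc a)))) ⟨
  (qpow (suc (suc b)) *P (x +P (qa *P y))) +P (y +P (qpow (suc (suc a)) *P z))  ∎
  where
  q  = qpow 1
  qa = qpow (suc a)
  qb = qpow (suc b)
  x  = gauss₂ a (suc (suc b))
  y  = gauss₂ (suc a) (suc b)
  z  = gauss₂ (suc (suc a)) b

gauss₂-sym : ∀ a b → gauss₂ a b ≋ gauss₂ b a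
gauss₂-sym zero    zero    = ℕ[q].refl
gauss₂-sym zero    (suc b) = ℕ[q].refl
gauss₂-sym (suc a) zero    = ℕ[q].refl
gauss₂-sym (suc a) (suc b) = begin
  gauss₂ a (suc b) +P (qpow (suc a) *P gauss₂ (suc a) b)
    ≈⟨ ℕ[q].+-cong (gauss₂-sym a (suc b)) (ℕ[q].*-congˡ {qpow (suc a)} (gauss₂-sym (suc a) b)) ⟩
  gauss₂ (suc b) a +P (qpow (suc a) *P gauss₂ b (suc a))
    ≈⟨ ℕ[q].+-comm (gauss₂ (suc b) a) _ ⟩
  (qpow (suc a) *P gauss₂ b (suc a)) +P gauss₂ (suc b) a
    ≈⟨ gauss₂-dualPascal b a ⟨
  gauss₂ (suc b) (suc a)  ∎

gauss-sym : ∀ a b → gauss (a + b) a ≋ gauss (a + b) b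
gauss-sym a b = begin
  gauss (a + b) a  ≈⟨ gauss≋gauss₂ a b ⟩
  gauss₂ a b       ≈⟨ gauss₂-sym a b ⟩
  gauss₂ b a       ≈⟨ gauss≋gauss₂ b a ⟨
  gauss (b + a) b  ≡⟨ ≡.cong (λ n → gauss n b) (+-comm b a) ⟩
  gauss (a + b) b  ∎

∑ : {X : Set} → List X → (X → Poly) → Poly
∑ L g = sumP (map g L)

when : Bool → Poly → Poly
when β p = if β then p else []

module _ {X : Set} where

  ∑-cong : ∀ (L : List X) {g h} → (∀ {x} → x ∈ L → g x ≋ h x) → ∑ L g ≋ ∑ L h
  ∑-cong []      e = ℕ[q].refl
  ∑-cong (x ∷ L) e = ℕ[q].+-cong (e (here ≡.refl)) (∑-cong L (e ∘ there))

  ∑-zero : ∀ (L : List X) {g} → (∀ {x} → x ∈ L → g x ≋ []) → ∑ L g ≋ []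
  ∑-zero []      e = ℕ[q].refl
  ∑-zero (x ∷ L) e = ℕ[q].+-cong (e (here ≡.refl)) (∑-zero L (e ∘ there))

  ∑-+ : ∀ (L : List X) g h → ∑ L (λ x → g x +P h x) ≋ (∑ L g +P ∑ L h)
  ∑-+ []      g h = ℕ[q].refl
  ∑-+ (x ∷ L) g h = ℕ[q].trans (ℕ[q].+-congˡ (∑-+ L g h)) (interchange (g x) (h x) (∑ L g) (∑ L h))

  ∑-* : ∀ (L : List X) p g → ∑ L (λ x → p *P g x) ≋ (p *P ∑ L g)
  ∑-* []      p g = ℕ[q].sym (ℕ[q].zeroʳ p)
  ∑-* (x ∷ L) p g = ℕ[q].trans (ℕ[q].+-congˡ (∑-* L p g)) (ℕ[q].sym (ℕ[q].distribˡ p (g x) (∑ L g)))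

  ∑-++ : ∀ (L M : List X) g → ∑ (L ++ M) g ≋ (∑ L g +P ∑ M g)
  ∑-++ []      M g = ℕ[q].refl
  ∑-++ (x ∷ L) M g = ℕ[q].trans (ℕ[q].+-congˡ (∑-++ L M g)) (ℕ[q].sym (ℕ[q].+-assoc (g x) (∑ L g) (∑ M g)))

  ∑-↭ : ∀ {L M : List X} g → L ↭ M → ∑ L g ≋ ∑ M g
  ∑-↭ g ↭.refl         = ℕ[q].refl
  ∑-↭ g (↭.prep x r)   = ℕ[q].+-congˡ (∑-↭ g r)
  ∑-↭ g (↭.swap x y r) = ℕ[q].trans (ℕ[q].+-congˡ {g x} (ℕ[q].+-congˡ {g y} (∑-↭ g r))) (x∙yz≈y∙xz (g x) (g y) _)
  ∑-↭ g (↭.trans r s)  = ℕ[q].trans (∑-↭ g r) (∑-↭ g s)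

  ∑-filterᵇ : ∀ (L : List X) p g → ∑ (filterᵇ p L) g ≋ ∑ L (λ x → when (p x) (g x))
  ∑-filterᵇ []      p g = ℕ[q].refl
  ∑-filterᵇ (x ∷ L) p g with p x
  ... | true  = ℕ[q].+-congˡ (∑-filterᵇ L p g)
  ... | false = ∑-filterᵇ L p g

∑-cartesianProductWith : ∀ {X Y Z : Set} (f : X → Y → Z) L M g →
  ∑ (cartesianProductWith f L M) g ≋ ∑ L (λ x → ∑ M (λ y → g (f x y)))
∑-cartesianProductWith f []      M g = ℕ[q].refl
∑-cartesianProductWith f (x ∷ L) M g = begin
  ∑ (map (f x) M ++ cartesianProductWith f L M) g
    ≈⟨ ∑-++ (map (f x) M) _ g ⟩
  ∑ (map (f x) M) g +P ∑ (cartesianProductWith f L M) g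
    ≈⟨ ℕ[q].+-cong (ℕ[q].reflexive (≡.cong sumP (≡.sym (map-∘ M)))) (∑-cartesianProductWith f L M g) ⟩
  ∑ M (λ y → g (f x y)) +P ∑ L (λ x → ∑ M (λ y → g (f x y)))  ∎

∑-upTo : ∀ m g → ∑ (upTo (suc m)) g ≋ (∑ (upTo m) g +P g m)
∑-upTo m g = begin
  ∑ (upTo (suc m)) g        ≡⟨ ≡.cong (λ L → ∑ L g) (upTo-∷ʳ m) ⟨
  ∑ (upTo m ++ [ m ]) g     ≈⟨ ∑-++ (upTo m) [ m ] g ⟩
  ∑ (upTo m) g +P (g m +P [])  ≈⟨ ℕ[q].+-congˡ (ℕ[q].+-identityʳ (g m)) ⟩
  ∑ (upTo m) g +P g m       ∎

≡ᵇ-refl : ∀ n → (n ≡ᵇ n) ≡ true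
≡ᵇ-refl zero    = ≡.refl
≡ᵇ-refl (suc n) = ≡ᵇ-refl n

≢⇒≡ᵇ : ∀ {m n} → m ≢ n → (m ≡ᵇ n) ≡ false
≢⇒≡ᵇ {m} {n} m≢n with m ≡ᵇ n in eq
... | false = ≡.refl
... | true  = ⊥-elim (m≢n (≡ᵇ⇒≡ m n (≡.subst T (≡.sym eq) _)))

∑-point : ∀ {L k} (g : ℕ → Poly) → Unique L → k ∈ L → ∑ L (λ c → when (c ≡ᵇ k) (g c)) ≋ g k
∑-point {c ∷ L} {k} g (c∉L ∷ _) (here ≡.refl) rewrite ≡ᵇ-refl c =
  ℕ[q].trans (ℕ[q].+-congˡ {g c} (∑-zero L λ {x} x∈L → ℕ[q].reflexive
    (≡.cong (λ β → when β (g x)) (≢⇒≡ᵇ (λ x≡c → All.lookup c∉L x∈L (≡.sym x≡c))))))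
    (ℕ[q].+-identityʳ (g c))
∑-point {c ∷ L} {k} g (c∉L ∷ uL) (there k∈L) rewrite ≢⇒≡ᵇ (All.lookup c∉L k∈L) = ∑-point g uL k∈L

≼⇒≤P : ∀ {p r} → p ≼ r → p ≤P r
≼⇒≤P {p} (mk≼ {rest} e) d = ≡.subst (coeff p d ≤_) (≡.trans (≡.sym (coeff-+ p rest d)) (coeffs e d)) (m≤m+n _ _)

-- Multiplication by a power of q only shifts coefficients. This carries a zero of the sequence b
-- back to a zero of a suffix sum.
qpow-cancel-zero : ∀ e {p} → (qpow e *P p) ≋ [] → p ≋ []
qpow-cancel-zero zero    {p} z = ℕ[q].trans (ℕ[q].sym (ℕ[q].*-identityˡ p)) z
qpow-cancel-zero (suc e) {p} z = qpow-cancel-zero e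
  (mk≋ λ d → coeffs (ℕ[q].trans (ℕ[q].sym (0∷-*P (qpow e) p)) z) (suc d))

-- Both pairs of exponents have the same sum, provided that no subtraction is truncated; the bound
-- by `N` ensures this.
qpow-geometric : ∀ N i e → suc (suc (i + e)) ≤ N →
  (qpow (N ∸ i) *P qpow (N ∸ suc (suc (i + e)))) ≋ (qpow (N ∸ suc i) *P qpow (N ∸ suc (i + e)))
qpow-geometric (suc N) i e (s≤s j≤N) = begin
  qpow (suc N ∸ i) *P qpow (N ∸ suc (i + e))    ≈⟨ qpow-+ (suc N ∸ i) _ ⟨
  qpow ((suc N ∸ i) + (N ∸ suc (i + e)))        ≡⟨ ≡.cong qpow exponents ⟩
  qpow ((N ∸ i) + (N ∸ (i + e)))                ≈⟨ qpow-+ (N ∸ i) _ ⟩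
  qpow (N ∸ i) *P qpow (N ∸ (i + e))            ∎
  where
  exponents : (suc N ∸ i) + (N ∸ suc (i + e)) ≡ (N ∸ i) + (N ∸ (i + e))
  exponents = ≡.trans
    (≡.cong (_+ (N ∸ suc (i + e))) (+-∸-assoc 1 (≤-trans (m≤m+n i e) (<⇒≤ j≤N))))
    (≡.trans (≡.sym (+-suc (N ∸ i) _)) (≡.cong ((N ∸ i) +_) (≡.sym (∸-suc N (i + e) j≤N))))
    where
    ∸-suc : ∀ n m → m < n → n ∸ m ≡ suc (n ∸ suc m)
    ∸-suc (suc n) m (s≤s m≤n) = +-∸-assoc 1 m≤n

-- Coefficients in ℕ cannot cancel. It will follow that once a suffix sum vanishes, all shorter ones
-- do.
+-zeroʳ⁻ : ∀ {p r} → (p +P r) ≋ [] → r ≋ []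
+-zeroʳ⁻ {p} {r} z = mk≋ λ d → m+n≡0⇒n≡0 (coeff p d) (≡.trans (≡.sym (coeff-+ p r d)) (coeffs z d))

-- [ x − k , N ] for k ≤ x, and 0 for x < k (where x ∸ k = 0 would give [ 0 , 0 ] = 1 for N = 0).
gaussShift : ℕ → ℕ → ℕ → Poly
gaussShift zero    x       N = gauss x N
gaussShift (suc k) zero    N = []
gaussShift (suc k) (suc x) N = gaussShift k x N

gaussShift-0 : ∀ k N → gaussShift k 0 (suc N) ≡ []
gaussShift-0 zero    N = ≡.refl
gaussShift-0 (suc k) N = ≡.refl

gaussShift-pascal : ∀ k x N →
  gaussShift k (suc x) (suc N) ≋ (gaussShift k x N +P (qpow (suc N) *P gaussShift k x (suc N)))
gaussShift-pascal zero    x       N = ℕ[q].refl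
-- At the edge of the range the left side may be [ 0 , N + 1 ], which is 0 because the lower index
-- is positive; so extending by zero respects the Pascal rule.
gaussShift-pascal (suc k) zero    N = ℕ[q].trans (ℕ[q].reflexive (gaussShift-0 k N)) (ℕ[q].sym (ℕ[q].zeroʳ (qpow (suc N))))
gaussShift-pascal (suc k) (suc x) N = gaussShift-pascal k x N

gaussShift-≤ : ∀ {k x} N → k ≤ x → gaussShift k x N ≡ gauss (x ∸ k) N
gaussShift-≤ N z≤n       = ≡.refl
gaussShift-≤ N (s≤s k≤x) = gaussShift-≤ N k≤x

gaussShift-> : ∀ {k x} N → x < k → gaussShift k x N ≡ []
gaussShift-> {suc k} {zero}  N _         = ≡.refl
gaussShift-> {suc k} {suc x} N (s≤s x<k) = gaussShift-> N x<k

gauss-n-0 : ∀ n → gauss n 0 ≡ [ 1 ]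
gauss-n-0 zero    = ≡.refl
gauss-n-0 (suc n) = ≡.refl

indicator-<ᵇ-suc : ∀ k x → indicator (x <ᵇ suc k) ≡ indicator (x <ᵇ k) + indicator (x ≡ᵇ k)
indicator-<ᵇ-suc zero    zero    = ≡.refl
indicator-<ᵇ-suc (suc k) zero    = ≡.refl
indicator-<ᵇ-suc zero    (suc x) = ≡.refl
indicator-<ᵇ-suc (suc k) (suc x) = indicator-<ᵇ-suc k x

indicator-atLeast : ∀ k x → indicator (atLeast k x) ≡ indicator (x ≡ᵇ k) + indicator (atLeast (suc k) x)
indicator-atLeast zero    zero    = ≡.refl
indicator-atLeast (suc k) zero    = ≡.refl
indicator-atLeast zero    (suc x) = ≡.refl
indicator-atLeast (suc k) (suc x) = indicator-atLeast k x

when-∧ : ∀ α β {p} → when (α ∧ β) p ≡ when α (when β p)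
when-∧ true  β = ≡.refl
when-∧ false β = ≡.refl

-- The equation between indicators, taken in ℕ, says that `β` is the disjoint union of `γ` and `δ`.
when-split : ∀ α β γ δ p → indicator β ≡ indicator γ + indicator δ →
  when (α ∧ β) p ≋ (when (α ∧ γ) p +P when (α ∧ δ) p)
when-split false β     γ     δ     p e = ℕ[q].refl
when-split true  true  true  false p e = ℕ[q].sym (ℕ[q].+-identityʳ p)
when-split true  true  false true  p e = ℕ[q].refl
when-split true  false false false p e = ℕ[q].refl

-- Generating polynomials refined by the last entry

module Recursion (S : List ℕ) where
  open Pattern S

  -- A predicate on the last entry covers f_n(k) (`exactly`), its sums over j < k (`below`) and over
  -- j ≥ k (`above`) at once, so that splitting, vanishing and the recursion are each proved once.
  W : ℕ → (ℕ → Bool) → Poly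
  W n φ = ∑ (Perms n) (λ w → when (fits 1 w ∧ φ (lastEntry w)) (qpow (inv w)))

  exactly below above : ℕ → ℕ → Poly
  exactly n k = W n (_≡ᵇ k)
  below   n k = W n (_<ᵇ k)
  above   n k = W n (atLeast k)

  W-split : ∀ n {φ ψ χ} → (∀ x → indicator (φ x) ≡ indicator (ψ x) + indicator (χ x)) →
            W n φ ≋ (W n ψ +P W n χ)
  W-split n {φ} {ψ} {χ} e = ℕ[q].trans
    (∑-cong (Perms n) λ {w} _ → when-split (fits 1 w) (φ (lastEntry w)) _ _ (qpow (inv w)) (e (lastEntry w)))
    (∑-+ (Perms n) _ _)

  -- The last entry of a nonempty permutation lies in 1, ..., n. The empty word has the default last
  -- entry 0, outside that range, hence `0 < n`.
  W-zero : ∀ n {φ} → (∀ x → InRange n x → φ x ≡ false) → 0 < n → W n φ ≋ []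
  W-zero (suc n) {φ} e _ = ∑-zero (Perms (suc n)) λ {w} w∈ → ℕ[q].reflexive
    (≡.trans (≡.cong (λ β → when (fits 1 w ∧ β) (qpow (inv w))) (e _ (lastEntry-InRange (∈-Perms⁻ (suc n) w∈))))
             (∧-false (fits 1 w)))
    where
    ∧-false : ∀ α {p} → when (α ∧ false) p ≡ []
    ∧-false true  = ≡.refl
    ∧-false false = ≡.refl

  W-cong : ∀ n {φ ψ} → (∀ x → φ x ≡ ψ x) → W n φ ≋ W n ψ
  W-cong n e = ∑-cong (Perms n) λ {w} _ →
    ℕ[q].reflexive (≡.cong (λ β → when (fits 1 w ∧ β) (qpow (inv w))) (e (lastEntry w)))

  below-suc : ∀ n k → below n (suc k) ≋ (below n k +P exactly n k)
  below-suc n k = W-split n {_<ᵇ suc k} {_<ᵇ k} {_≡ᵇ k} (indicator-<ᵇ-suc k)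

  above-step : ∀ n k → above n k ≋ (exactly n k +P above n (suc k))
  above-step n k = W-split n {atLeast k} {_≡ᵇ k} {atLeast (suc k)} (indicator-atLeast k)

  below-0 : ∀ n → 0 < n → below n 0 ≋ []
  below-0 n = W-zero n λ _ _ → ≡.refl

  above-big : ∀ n → 0 < n → ∀ k → n < k → above n k ≋ []
  above-big n 0<n k n<k = W-zero n (λ x r → ≡.cong not (<⇒<ᵇ≡true (≤-<-trans (proj₂ r) n<k))) 0<n

  exactly-0 : ∀ n → 0 < n → exactly n 0 ≋ []
  exactly-0 n = W-zero n {_≡ᵇ 0} λ { (suc x) _ → ≡.refl }

  exactly-big : ∀ n → 0 < n → ∀ k → n < k → exactly n k ≋ []
  exactly-big n 0<n k n<k =
    W-zero n {_≡ᵇ k} (λ x r → ≢⇒≡ᵇ (<⇒≢ (≤-<-trans (proj₂ r) n<k))) 0<n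

  -- `Perms (suc n)` turns the sum into a double sum over the rest `w` and the last entry `c`, and
  -- the test on the last entry keeps only `c = k`. Appending `k` then adds the same number of
  -- inversions for every `w`, which gives the factor, and one comparison at position `n`, which
  -- gives the new predicate.
  exactly-suc : ∀ n → 0 < n → ∀ k → InRange (suc n) k →
    exactly (suc n) k ≋ (qpow (suc n ∸ k) *P W n (λ x → agrees n (atLeast k x)))
  exactly-suc (suc n) _ k r = begin
    exactly (suc (suc n)) k
      ≈⟨ ∑-cartesianProductWith append (Perms (suc n)) [1‥ suc (suc n) ] _ ⟩
    ∑ (Perms (suc n)) (λ w → ∑ [1‥ suc (suc n) ] λ c →
      when (fits 1 (append w c) ∧ (lastEntry (append w c) ≡ᵇ k)) (qpow (inv (append w c))))
      ≈⟨ ∑-cong (Perms (suc n)) (λ {w} _ → ∑-cong [1‥ suc (suc n) ] λ {c} _ →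
           ℕ[q].reflexive (≡.trans
             (≡.cong (λ l → when (fits 1 (append w c) ∧ (l ≡ᵇ k)) (qpow (inv (append w c)))) (lastEntry-∷ʳ (map (punchIn c) w) c))
             (≡.trans (≡.cong (λ β → when β (qpow (inv (append w c)))) (∧-comm (fits 1 (append w c)) (c ≡ᵇ k))) (when-∧ (c ≡ᵇ k) (fits 1 (append w c)))))) ⟩
    ∑ (Perms (suc n)) (λ w → ∑ [1‥ suc (suc n) ] λ c →
      when (c ≡ᵇ k) (when (fits 1 (append w c)) (qpow (inv (append w c)))))
      ≈⟨ ∑-cong (Perms (suc n)) (λ {w} _ →
           ∑-point (λ c → when (fits 1 (append w c)) (qpow (inv (append w c)))) ([1‥]-unique (suc (suc n))) (∈[1‥]⁺ r)) ⟩
    ∑ (Perms (suc n)) (λ w → when (fits 1 (append w k)) (qpow (inv (append w k))))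
      ≈⟨ ∑-cong (Perms (suc n)) pointwise ⟩
    ∑ (Perms (suc n)) (λ w → qpow e *P when (fits 1 w ∧ agrees (suc n) (atLeast k (lastEntry w))) (qpow (inv w)))
      ≈⟨ ∑-* (Perms (suc n)) (qpow e) _ ⟩
    qpow e *P W (suc n) (λ x → agrees (suc n) (atLeast k x))  ∎
    where
    e = suc (suc n) ∸ k
    when-* : ∀ β p r → when β (p *P r) ≋ (p *P when β r)
    when-* true  p r = ℕ[q].refl
    when-* false p r = ℕ[q].sym (ℕ[q].zeroʳ p)
    pointwise : ∀ {w} → w ∈ Perms (suc n) →
      when (fits 1 (append w k)) (qpow (inv (append w k)))
        ≋ (qpow e *P when (fits 1 w ∧ agrees (suc n) (atLeast k (lastEntry w))) (qpow (inv w)))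
    pointwise {w} w∈ = begin
      when (fits 1 (append w k)) (qpow (inv (append w k)))
        ≡⟨ ≡.cong₂ (λ β i → when β (qpow i)) (fits-append (∈-Perms⁻ (suc n) w∈) k) inversions ⟩
      when β (qpow (e + inv w))
        ≈⟨ when-cong β (qpow-+ e (inv w)) ⟩
      when β (qpow e *P qpow (inv w))
        ≈⟨ when-* β (qpow e) (qpow (inv w)) ⟩
      qpow e *P when β (qpow (inv w))  ∎
      where
      β = fits 1 w ∧ agrees (suc n) (atLeast k (lastEntry w))
      when-cong : ∀ β {p r} → p ≋ r → when β p ≋ when β r
      when-cong true  p≋r = p≋r
      when-cong false _   = ℕ[q].refl
      inversions : inv (append w k) ≡ e + inv w
      inversions = ≡.trans (inv-append w k) (≡.trans (+-comm (inv w) _) (≡.cong (_+ inv w)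
        (≡.trans (≡.sym (m+n∸n≡m _ k)) (≡.cong (_∸ k) (count-atLeast (suc n) w∈ k r)))))

  exactly-descent : ∀ n → 0 < n → elemᵇ n S ≡ true → ∀ k → InRange (suc n) k →
    exactly (suc n) k ≋ (qpow (suc n ∸ k) *P above n k)
  exactly-descent n 0<n n∈S k r = ℕ[q].trans (exactly-suc n 0<n k r)
    (ℕ[q].*-congˡ {qpow (suc n ∸ k)} (W-cong n λ x → ≡.cong (if_then atLeast k x else not (atLeast k x)) n∈S))

  exactly-ascent : ∀ n → 0 < n → elemᵇ n S ≡ false → ∀ k → InRange (suc n) k →
    exactly (suc n) k ≋ (qpow (suc n ∸ k) *P below n k)
  exactly-ascent n 0<n n∉S k r = ℕ[q].trans (exactly-suc n 0<n k r)
    (ℕ[q].*-congˡ {qpow (suc n ∸ k)} (W-cong n λ x →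
      ≡.trans (≡.cong (if_then atLeast k x else not (atLeast k x)) n∉S) (not-involutive (x <ᵇ k))))

  exactly-StepLC : ∀ n → StepLC (exactly (suc n))
  -- The sequence f_1 is supported at 1 alone, and the outer indices differ by at least two: one of
  -- them is 0 or exceeds 1.
  exactly-StepLC zero zero    e = 0≼ (ℕ[q].*-congʳ {exactly 1 (suc (suc e))} (exactly-0 1 (s≤s z≤n)))
  exactly-StepLC zero (suc i) e = 0≼ (ℕ[q].trans
    (ℕ[q].*-congˡ {exactly 1 (suc i)} (exactly-big 1 (s≤s z≤n) (suc (suc (suc i + e))) (s≤s (s≤s z≤n)))) (ℕ[q].zeroʳ (exactly 1 (suc i))))
  exactly-StepLC (suc n) = go (elemᵇ (suc n) S) ≡.refl
    where
    N = suc (suc n)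
    scaled : ∀ s → StepLC s →
      (∀ k → 0 < k → k ≤ N → exactly N k ≋ (qpow (N ∸ k) *P s k)) → StepLC (exactly N)
    scaled s lc = scaled-StepLC {s = s} {w = λ k → qpow (N ∸ k)} N lc (qpow-geometric N)
      (exactly-0 N (s≤s z≤n)) (exactly-big N (s≤s z≤n))
    go : ∀ β → elemᵇ (suc n) S ≡ β → StepLC (exactly N)
    go true  eq = scaled (above (suc n))
      (suffixSums-StepLC {exactly (suc n)} {above (suc n)} (StepLC⇒LC {exactly (suc n)} (exactly-StepLC n)) N (λ k → above-big (suc n) (s≤s z≤n) k) (above-step (suc n)))
      (λ k 0<k k≤N → exactly-descent (suc n) (s≤s z≤n) eq k (0<k , k≤N))
    go false eq = scaled (below (suc n))
      (prefixSums-StepLC {exactly (suc n)} {below (suc n)} (StepLC⇒LC {exactly (suc n)} (exactly-StepLC n)) (below-0 (suc n) (s≤s z≤n)) (below-suc (suc n)))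
      (λ k 0<k k≤N → exactly-ascent (suc n) (s≤s z≤n) eq k (0<k , k≤N))

-- The expansion of D_S and the sequence b_k

maxL-upper : ∀ S {j} → j ∈ S → j ≤ maxL S
maxL-upper (s ∷ S) (here ≡.refl) = m≤m⊔n s (maxL S)
maxL-upper (s ∷ S) (there j∈)    = ≤-trans (maxL-upper S j∈) (m≤n⊔m s (maxL S))

maxL-∈ : ∀ S → S ≢ [] → maxL S ∈ S
maxL-∈ []      S≢[] = ⊥-elim (S≢[] ≡.refl)
maxL-∈ (s ∷ S) _    = go s S
  where
  go : ∀ s S → maxL (s ∷ S) ∈ s ∷ S
  go s []      = here (⊔-identityʳ s)
  go s (t ∷ S) with ⊔-sel s (maxL (t ∷ S))
  ... | inj₁ eq = here eq
  ... | inj₂ eq = there (≡.subst (_∈ (t ∷ S)) (≡.sym eq) (go t S))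

at-applyUpTo : ∀ (g : ℕ → Poly) h {n i} → i < n → at (map g (applyUpTo h n)) i ≡ g (h i)
at-applyUpTo g h {suc n} {zero}  _         = ≡.refl
at-applyUpTo g h {suc n} {suc i} (s≤s i<n) = at-applyUpTo g (h ∘ suc) i<n

at-applyUpTo-big : ∀ (g : ℕ → Poly) h {n i} → n ≤ i → at (map g (applyUpTo h n)) i ≡ []
at-applyUpTo-big g h {zero}           _         = ≡.refl
at-applyUpTo-big g h {suc n} {suc i}  (s≤s n≤i) = at-applyUpTo-big g (h ∘ suc) n≤i

module Main (S : List ℕ) (S≢[] : S ≢ []) (S-pos : All (λ s → 0 < s) S) where
  open Pattern S
  open Recursion S

  m M : ℕ
  m = maxL S
  M = suc m

  0<m : 0 < m
  0<m = All.lookup S-pos (maxL-∈ S S≢[])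

  m-descent : elemᵇ m S ≡ true
  m-descent with elemᵇ m S | T-elemᵇ⁺ (maxL-∈ S S≢[])
  ... | true | _ = ≡.refl

  ascent-after : ∀ n → m < n → elemᵇ n S ≡ false
  ascent-after n m<n with elemᵇ n S in eq
  ... | false = ≡.refl
  ... | true  = ⊥-elim (<⇒≱ m<n (maxL-upper S (T-elemᵇ⁻ S (≡.subst T (≡.sym eq) _))))

  exactly-M : ∀ k → InRange M k → exactly M k ≋ (qpow (M ∸ k) *P above m k)
  exactly-M = exactly-descent m 0<m m-descent

  -- Position m is a descent, so the entry at m + 1 cannot be the maximum m + 1. This is why the
  -- sums may stop at k = m.
  exactly-M-M : exactly M M ≋ []
  exactly-M-M = ℕ[q].trans (exactly-M M (s≤s z≤n , ≤-refl))
    (ℕ[q].trans (ℕ[q].*-congˡ {qpow (M ∸ M)} (above-big m 0<m M ≤-refl)) (ℕ[q].zeroʳ (qpow (M ∸ M))))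

  ∑-A : ∀ n g → ∑ (A S n) g ≋ ∑ (Perms n) (λ w → when (sameSet (Des w) S) (g w))
  ∑-A n g = ℕ[q].trans (∑-filterᵇ (Sym n) _ g) (∑-↭ _ (Sym↭Perms n))

  sameSet-long : ∀ {n w} → m < n → PermWord n w → sameSet (Des w) S ≡ fits 1 w
  sameSet-long {w = x ∷ w} m<n (permWord ≡.refl _ _) = sameSet≡fits x w
    λ j∈ → All.lookup S-pos j∈ , ≤-trans (maxL-upper S j∈) (≤-pred m<n)
  sameSet-long {w = []} () (permWord ≡.refl _ _)

  sameSet-short : ∀ {w} → PermWord m w → sameSet (Des w) S ≡ false
  sameSet-short {[]}    (permWord l _ _) = ⊥-elim (<-irrefl l 0<m)
  sameSet-short {x ∷ w} (permWord l _ _) = sameSet≡false x w (maxL-∈ S S≢[]) (≤-reflexive l)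

  b≋exactly : ∀ k → b S k ≋ exactly M k
  b≋exactly zero    = ℕ[q].sym (exactly-0 M (s≤s z≤n))
  b≋exactly (suc k) = begin
    b S (suc k)
      ≈⟨ ∑-filterᵇ (A S M) (λ w → lastEntry w ≡ᵇ suc k) (λ w → qpow (inv w)) ⟩
    ∑ (A S M) (λ w → when (lastEntry w ≡ᵇ suc k) (qpow (inv w)))
      ≈⟨ ∑-A M _ ⟩
    ∑ (Perms M) (λ w → when (sameSet (Des w) S) (when (lastEntry w ≡ᵇ suc k) (qpow (inv w))))
      ≈⟨ ∑-cong (Perms M) (λ {w} w∈ → ℕ[q].reflexive (≡.trans
           (≡.cong (λ β → when β (when (lastEntry w ≡ᵇ suc k) (qpow (inv w)))) (sameSet-long ≤-refl (∈-Perms⁻ M w∈)))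
           (≡.sym (when-∧ (fits 1 w) (lastEntry w ≡ᵇ suc k))))) ⟩
    exactly M (suc k)  ∎

  D≋below : ∀ n → m < n → D S n ≋ below n (suc n)
  D≋below (suc n) m<n = ℕ[q].trans (∑-A (suc n) _) (∑-cong (Perms (suc n)) λ {w} w∈ →
    ℕ[q].reflexive (≡.cong (λ β → when β (qpow (inv w)))
      (≡.trans (sameSet-long m<n (∈-Perms⁻ (suc n) w∈))
        (≡.trans (≡.sym (∧-identityʳ (fits 1 w))) (≡.cong (fits 1 w ∧_)
          (≡.sym (<⇒<ᵇ≡true (s≤s (proj₂ (lastEntry-InRange (∈-Perms⁻ (suc n) w∈)))))))))))

  D-m : D S m ≋ []
  D-m = ℕ[q].trans (∑-A m _) (∑-zero (Perms m) λ {w} w∈ →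
    ℕ[q].reflexive (≡.cong (λ β → when β (qpow (inv w))) (sameSet-short (∈-Perms⁻ m w∈))))

  combination : ℕ → ℕ → Poly
  combination x N = ∑ (upTo M) (λ k → exactly M k *P gaussShift k x N)

  -- `gaussShift k x 0` is the indicator of `k ≤ x`, so the combination is a prefix sum of f_{m+1}.
  -- Its partial sums stop growing at `suc x`, hence the minimum in `partial`.
  combination-0 : ∀ x → x ≤ M → combination x 0 ≋ below M (suc x)
  combination-0 x x≤M = ℕ[q].trans (partial M) end
    where
    partial : ∀ K → ∑ (upTo K) (λ k → exactly M k *P gaussShift k x 0) ≋ below M (K ⊓ suc x)
    partial zero    = ℕ[q].sym (below-0 M (s≤s z≤n))
    partial (suc K) with K ≤? x
    ... | yes K≤x = begin
      ∑ (upTo (suc K)) _                              ≈⟨ ∑-upTo K (λ k → exactly M k *P gaussShift k x 0) ⟩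
      ∑ (upTo K) _ +P (exactly M K *P gaussShift K x 0)
        ≈⟨ ℕ[q].+-cong (partial K) (ℕ[q].*-congˡ {exactly M K} (ℕ[q].reflexive
             (≡.trans (gaussShift-≤ 0 K≤x) (gauss-n-0 (x ∸ K))))) ⟩
      below M (K ⊓ suc x) +P (exactly M K *P [ 1 ])
        ≈⟨ ℕ[q].+-cong (ℕ[q].reflexive (≡.cong (below M) (m≤n⇒m⊓n≡m (m≤n⇒m≤1+n K≤x)))) (ℕ[q].*-identityʳ (exactly M K)) ⟩
      below M K +P exactly M K                        ≈⟨ below-suc M K ⟨
      below M (suc K)                                 ≡⟨ ≡.cong (below M ∘ suc) (m≤n⇒m⊓n≡m K≤x) ⟨
      below M (suc K ⊓ suc x)                         ∎
    ... | no K≰x = begin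
      ∑ (upTo (suc K)) _                              ≈⟨ ∑-upTo K (λ k → exactly M k *P gaussShift k x 0) ⟩
      ∑ (upTo K) _ +P (exactly M K *P gaussShift K x 0)
        ≈⟨ ℕ[q].+-cong (partial K) (ℕ[q].*-congˡ {exactly M K} (ℕ[q].reflexive (gaussShift-> 0 (≰⇒> K≰x)))) ⟩
      below M (K ⊓ suc x) +P (exactly M K *P [])
        ≈⟨ ℕ[q].+-congˡ {below M (K ⊓ suc x)} (ℕ[q].zeroʳ (exactly M K)) ⟩
      below M (K ⊓ suc x) +P []                       ≈⟨ ℕ[q].+-identityʳ (below M (K ⊓ suc x)) ⟩
      below M (K ⊓ suc x)
        ≡⟨ ≡.cong (below M) (≡.trans (m≥n⇒m⊓n≡n (≰⇒> K≰x)) (≡.sym (m≥n⇒m⊓n≡n (m≤n⇒m≤1+n (≰⇒> K≰x))))) ⟩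
      below M (suc K ⊓ suc x)                         ∎
    end : below M (M ⊓ suc x) ≋ below M (suc x)
    end with m≤n⇒m<n∨m≡n x≤M
    ... | inj₁ x<M    = ℕ[q].reflexive (≡.cong (below M) (m≥n⇒m⊓n≡n x<M))
    -- Only `x = M` asks for the term k = M, which `upTo M` omits; that term is zero.
    ... | inj₂ ≡.refl = begin
      below M (M ⊓ suc M)      ≡⟨ ≡.cong (below M) (m≤n⇒m⊓n≡m (n≤1+n M)) ⟩
      below M M                ≈⟨ ℕ[q].+-identityʳ (below M M) ⟨
      below M M +P []          ≈⟨ ℕ[q].+-congˡ {below M M} exactly-M-M ⟨
      below M M +P exactly M M ≈⟨ below-suc M M ⟨
      below M (suc M)          ∎

  combination-pascal : ∀ x N →
    combination (suc x) (suc N) ≋ (combination x N +P (qpow (suc N) *P combination x (suc N)))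
  combination-pascal x N = begin
    combination (suc x) (suc N)
      ≈⟨ ∑-cong (upTo M) (λ {k} _ → ℕ[q].trans
           (ℕ[q].*-congˡ {exactly M k} (gaussShift-pascal k x N))
           (expand (exactly M k) (gaussShift k x N) (qpow (suc N)) (gaussShift k x (suc N)))) ⟩
    ∑ (upTo M) (λ k → (exactly M k *P gaussShift k x N) +P (qpow (suc N) *P (exactly M k *P gaussShift k x (suc N))))
      ≈⟨ ∑-+ (upTo M) (λ k → exactly M k *P gaussShift k x N) _ ⟩
    combination x N +P ∑ (upTo M) (λ k → qpow (suc N) *P (exactly M k *P gaussShift k x (suc N)))
      ≈⟨ ℕ[q].+-congˡ {combination x N} (∑-* (upTo M) (qpow (suc N)) _) ⟩
    combination x N +P (qpow (suc N) *P combination x (suc N))  ∎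
    where
    expand : ∀ a g q h → (a *P (g +P (q *P h))) ≋ ((a *P g) +P (q *P (a *P h)))
    expand = solve 4 (λ a g q h → a :* (g :+ q :* h) := a :* g :+ q :* (a :* h)) ℕ[q].refl

  -- Here `c` is the number of values above `x`. In the main step the top value is split off. The
  -- shorter prefix sum has one more value above it, which releases the factor `qpow (suc N)`; the
  -- split-off term is, by the ascent recursion, `qpow c` times a prefix sum one level down. With
  -- `qpow (suc N * c)` taken out, these are the two terms of the Pascal rule.
  below-formula : ∀ N x c → x + c ≡ N + M → below (N + M) (suc x) ≋ (qpow (N * c) *P combination x N)
  below-formula zero x c e = ℕ[q].trans
    (ℕ[q].sym (combination-0 x (≤-trans (m≤m+n x c) (≤-reflexive e))))
    (ℕ[q].sym (ℕ[q].*-identityˡ (combination x 0)))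
  below-formula (suc N) zero c e = begin
    below n 1                          ≈⟨ below-suc n 0 ⟩
    below n 0 +P exactly n 0           ≈⟨ ℕ[q].+-cong (below-0 n (s≤s z≤n)) (exactly-0 n (s≤s z≤n)) ⟩
    []                                 ≈⟨ ℕ[q].zeroʳ (qpow (suc N * c)) ⟨
    qpow (suc N * c) *P []             ≈⟨ ℕ[q].*-congˡ {qpow (suc N * c)} (∑-zero (upTo M) λ {k} _ →
      ℕ[q].trans (ℕ[q].*-congˡ {exactly M k} (ℕ[q].reflexive (gaussShift-0 k N))) (ℕ[q].zeroʳ (exactly M k))) ⟨
    qpow (suc N * c) *P combination 0 (suc N)  ∎
    where n = suc N + M
  below-formula (suc N) (suc x) c e = begin
    below (suc n) (suc (suc x))
      ≈⟨ below-suc (suc n) (suc x) ⟩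
    below (suc n) (suc x) +P exactly (suc n) (suc x)
      ≈⟨ ℕ[q].+-cong (below-formula (suc N) x (suc c) (≡.trans (+-suc x c) e))
           (exactly-ascent n (≤-trans (s≤s z≤n) (m≤n+m M N)) (ascent-after n (m≤n+m M N)) (suc x) (s≤s z≤n , x<n)) ⟩
    (qpow (suc N * suc c) *P combination x (suc N)) +P (qpow (n ∸ x) *P below n (suc x))
      ≈⟨ ℕ[q].+-cong
           (ℕ[q].*-congʳ {combination x (suc N)} (ℕ[q].trans (ℕ[q].reflexive (≡.cong qpow (*-suc (suc N) c))) (qpow-+ (suc N) (suc N * c))))
           (ℕ[q].*-cong (ℕ[q].reflexive (≡.cong qpow n∸x≡c)) (below-formula N x c x+c≡n)) ⟩
    ((qpow (suc N) *P qpow (suc N * c)) *P combination x (suc N)) +P (qpow c *P (qpow (N * c) *P combination x N))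
      ≈⟨ ℕ[q].+-congˡ {(qpow (suc N) *P qpow (suc N * c)) *P combination x (suc N)}
           (ℕ[q].trans (ℕ[q].sym (ℕ[q].*-assoc (qpow c) (qpow (N * c)) (combination x N)))
             (ℕ[q].*-congʳ {combination x N} (ℕ[q].sym (qpow-+ c (N * c))))) ⟩
    ((qpow (suc N) *P qpow (suc N * c)) *P combination x (suc N)) +P (qpow (suc N * c) *P combination x N)
      ≈⟨ collect (qpow (suc N)) (qpow (suc N * c)) (combination x (suc N)) (combination x N) ⟩
    qpow (suc N * c) *P (combination x N +P (qpow (suc N) *P combination x (suc N)))
      ≈⟨ ℕ[q].*-congˡ {qpow (suc N * c)} (combination-pascal x N) ⟨
    qpow (suc N * c) *P combination (suc x) (suc N)  ∎
    where
    n = N + M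
    x+c≡n : x + c ≡ n
    x+c≡n = suc-injective e
    x<n : suc x ≤ suc n
    x<n = s≤s (≤-trans (m≤m+n x c) (≤-reflexive x+c≡n))
    n∸x≡c : n ∸ x ≡ c
    n∸x≡c = ≡.trans (≡.cong (_∸ x) (≡.sym x+c≡n)) (m+n∸m≡n x c)
    collect : ∀ q r s t → (((q *P r) *P s) +P (r *P t)) ≋ (r *P (t +P (q *P s)))
    collect = solve 4 (λ q r s t → q :* r :* s :+ r :* t := r :* (t :+ q :* s)) ℕ[q].refl

  expansion : ℕ → Poly
  expansion n = ∑ (upTo M) (λ k → b S k *P gauss (n ∸ k) (suc (m ∸ k)))

  D-long : ∀ N → D S (N + M) ≋ expansion (N + M)
  D-long N = begin
    D S n                                ≈⟨ D≋below n (m≤n+m M N) ⟩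
    below n (suc n)                      ≈⟨ below-formula N n 0 (+-identityʳ n) ⟩
    qpow (N * 0) *P combination n N      ≡⟨ ≡.cong (λ e → qpow e *P combination n N) (*-zeroʳ N) ⟩
    [ 1 ] *P combination n N             ≈⟨ ℕ[q].*-identityˡ (combination n N) ⟩
    combination n N                      ≈⟨ ∑-cong (upTo M) (λ {k} k∈ →
      ℕ[q].*-cong (ℕ[q].sym (b≋exactly k)) (flip k (≤-pred (∈-upTo⁻ k∈)))) ⟩
    expansion n  ∎
    where
    n = N + M
    -- Since n - k = N + (m - k + 1), the lower index of the recursion and the one of the theorem
    -- are complementary.
    flip : ∀ k → k ≤ m → gaussShift k n N ≋ gauss (n ∸ k) (suc (m ∸ k))
    flip k k≤m = begin
      gaussShift k n N                       ≡⟨ gaussShift-≤ N (≤-trans k≤M (m≤n+m M N)) ⟩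
      gauss (n ∸ k) N                        ≡⟨ ≡.cong (λ a → gauss a N) (+-∸-assoc N k≤M) ⟩
      gauss (N + (M ∸ k)) N                  ≈⟨ gauss-sym N (M ∸ k) ⟩
      gauss (N + (M ∸ k)) (M ∸ k)            ≡⟨ ≡.cong₂ gauss (≡.sym (+-∸-assoc N k≤M)) (+-∸-assoc 1 k≤m) ⟩
      gauss (n ∸ k) (suc (m ∸ k))            ∎
      where k≤M = m≤n⇒m≤1+n k≤m

  D-formula : ∀ n → m ≤ n → D S n ≋ expansion n
  D-formula n m≤n with m≤n⇒m<n∨m≡n m≤n
  ... | inj₁ m<n = ≡.subst (λ n → D S n ≋ expansion n) (m∸n+n≡m m<n) (D-long (n ∸ M))
  -- For n = m no permutation has a descent at m, and each [ m - k , m - k + 1 ] is zero.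
  ... | inj₂ ≡.refl = ℕ[q].trans D-m (ℕ[q].sym (∑-zero (upTo M) λ {k} _ →
    ℕ[q].trans (ℕ[q].*-congˡ {b S k} (gauss-above (m ∸ k) (suc (m ∸ k)) ≤-refl)) (ℕ[q].zeroʳ (b S k))))

  bs : List Poly
  bs = map (b S) (upTo M)

  bs-at : ∀ {i} → i < M → at bs i ≋ exactly M i
  bs-at {i} i<M = ℕ[q].trans (ℕ[q].reflexive (at-applyUpTo (b S) id i<M)) (b≋exactly i)

  bs-big : ∀ {i} → M ≤ i → at bs i ≋ []
  bs-big M≤i = ℕ[q].reflexive (at-applyUpTo-big (b S) id M≤i)

  bs-logConcave : ∀ i j → i ≤ j → (atPred bs i *P at bs (suc j)) ≤P (at bs i *P at bs j)
  bs-logConcave zero    j _   d = z≤n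
  bs-logConcave (suc i) j i<j with suc j <? M
  ... | no  j≮M = ≼⇒≤P {r = at bs (suc i) *P at bs j} (0≼ (ℕ[q].trans (ℕ[q].*-congˡ {at bs i} (bs-big (≮⇒≥ j≮M))) (ℕ[q].zeroʳ (at bs i))))
  ... | yes j<M = ≼⇒≤P (≼-resp
    (ℕ[q].*-cong (ℕ[q].sym (bs-at i<M)) (ℕ[q].sym (bs-at j<M)))
    (ℕ[q].*-cong (ℕ[q].sym (bs-at i+1<M)) (ℕ[q].sym (bs-at j-1<M)))
    (≡.subst (λ j → (exactly M i *P exactly M (suc j)) ≼ (exactly M (suc i) *P exactly M j))
      (m+[n∸m]≡n i<j) (exactly-StepLC m i (j ∸ suc i))))
    where
    j-1<M = <⇒≤ j<M
    i+1<M = ≤-<-trans i<j j-1<M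
    i<M   = <⇒≤ i+1<M

  above-antitone-zero : ∀ n k d → above n k ≋ [] → above n (d + k) ≋ []
  above-antitone-zero n k zero    z = z
  above-antitone-zero n k (suc d) z =
    +-zeroʳ⁻ (ℕ[q].trans (ℕ[q].sym (above-step n (d + k))) (above-antitone-zero n k d z))

  bs-noInternalZeros : NoInternalZeros bs
  bs-noInternalZeros i j j' i<j j<j' _ j'≢0 j≡0 with j' <? M
  ... | no  j'≮M = j'≢0 (coeffs (bs-big (≮⇒≥ j'≮M)))
  ... | yes j'<M = j'≢0 (coeffs (begin
    at bs j'                    ≈⟨ bs-at j'<M ⟩
    exactly M j'                ≈⟨ exactly-M j' (≤-trans 0<j (<⇒≤ j<j') , <⇒≤ j'<M) ⟩
    qpow (M ∸ j') *P above m j' ≈⟨ ℕ[q].*-congˡ {qpow (M ∸ j')} above-j'≋0 ⟩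
    qpow (M ∸ j') *P []         ≈⟨ ℕ[q].zeroʳ (qpow (M ∸ j')) ⟩
    []                          ∎))
    where
    -- b_0 is zero although later terms need not be; `i < j` keeps `j` away from this leading zero,
    -- where b has no suffix-sum description.
    0<j : 0 < j
    0<j = ≤-trans (s≤s z≤n) i<j
    j<M : j < M
    j<M = <-trans j<j' j'<M
    above-j≋0 : above m j ≋ []
    above-j≋0 = qpow-cancel-zero (M ∸ j) (ℕ[q].trans (ℕ[q].sym (exactly-M j (0<j , <⇒≤ j<M)))
      (ℕ[q].trans (ℕ[q].sym (bs-at j<M)) (mk≋ j≡0)))
    above-j'≋0 : above m j' ≋ []
    above-j'≋0 = ≡.subst (λ k → above m k ≋ []) (m∸n+n≡m (<⇒≤ j<j'))
      (above-antitone-zero m j (j' ∸ j) above-j≋0)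

theorem2p2 : (S : List ℕ) → S ≢ [] → All (λ s → 0 < s) S →
    (∀ n → maxL S ≤ n →
    D S n ≈P sumP (map (λ k → b S k *P gauss (n ∸ k) (suc (maxL S ∸ k)))
    (upTo (suc (maxL S)))))
    × StronglyQLogConcave (map (b S) (upTo (suc (maxL S))))
theorem2p2 S S≢[] S-pos = (λ n m≤n → coeffs (D-formula n m≤n)) , bs-noInternalZeros , bs-logConcave
  where open Main S S≢[] S-pos
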